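{- Let $f(x)\in\mathbf{Z}[x]$ be a nonconstant separable polynomial, let $R(f)$ be the set of all primes $q$ that are good for $f(x)$ and such that $f(x)$ has a root modulo $q$, and let $T$ be a finite subset of $R(f)$. Then there exist infinitely many $d\in\mathcal{S}(f)$ such that $d$ is divisible by every prime in $T$.
   Context: Squarefree integers may be negative and are nonzero. For a nonzero rational number $r$, its squarefree part $S(r)$ is the unique squarefree integer $d$ such that $r/d$ is a square in $\mathbf{Q}$. For a separable nonconstant $f(x)\in\mathbf{Z}[x]$, $\mathcal{S}(f)=\{S(f(r)) : r\in\mathbf{Q},\ f(r)\neq 0\}$. An odd prime $q$ is good for $f(x)$ if the reduced polynomial $\bar f(x)\in\mathbf{F}_q[x]$ has the same degree as $f(x)$ and has nonzero discriminant. -}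

module Defs where

open import Algebra.Bundles using (CommutativeRing)
open import Data.Fin.Base using (Fin; zero; suc; toℕ; punchIn)
open import Data.Integer.Base as ℤ using (ℤ; +_; 0ℤ; 1ℤ)
open import Data.Integer.Divisibility.Signed
  using (_∣_; divides; ∣m∣n⇒∣m+n; ∣m⇒∣-m; ∣n⇒∣m*n; ∣m⇒∣m*n)
import Data.Integer.Properties as ℤ
open import Data.Integer.Tactic.RingSolver using (solve-∀)
open import Data.List.Base using (List; []; _∷_; map; replicate; _++_)
open import Data.List.Membership.Propositional using (_∉_)
open import Data.Nat.Base as ℕ using (ℕ; zero; suc; pred; _<_)
open import Data.Nat.DivMod using (_/_)
open import Data.Nat.Primality using (Prime)
open import Data.Product.Base using (∃; ∃-syntax; _×_; _,_)
open import Data.Rational.Base as ℚ using (ℚ; 0ℚ; _÷_)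
open import Data.Rational.Literals using (fromℤ)
import Data.Rational.Properties as ℚ
import Data.Vec.Functional as Vector
open import Level using (0ℓ)
open import Relation.Binary.PropositionalEquality
  using (_≡_; _≢_; refl; sym; cong; subst)
open import Relation.Nullary.Negation using (¬_)

module Polynomial {c ℓ} (R : CommutativeRing c ℓ) where

  open CommutativeRing R renaming (Carrier to A) hiding (zero; refl; sym)
  open import Algebra.Properties.Monoid.Sum +-monoid using (sum)
  open import Algebra.Properties.Semiring.Exp semiring using (_^_)
  open import Algebra.Properties.Semiring.Mult semiring
    using () renaming (_×_ to _·_)

  -- Coefficients with the constant term first.  Trailing zeros are
  -- allowed, so polynomial equality is _≈ₚ_ and not _≡_.
  Poly : Set c
  Poly = List A

  coeff : Poly → ℕ → A
  coeff []      _       = 0#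
  coeff (a ∷ p) zero    = a
  coeff (a ∷ p) (suc i) = coeff p i

  infix 4 _≈ₚ_
  _≈ₚ_ : Poly → Poly → Set ℓ
  p ≈ₚ q = ∀ i → coeff p i ≈ coeff q i

  HasDegree : Poly → ℕ → Set ℓ
  HasDegree p n = ¬ (coeff p n ≈ 0#) × (∀ i → n < i → coeff p i ≈ 0#)

  eval : Poly → A → A
  eval []      x = 0#
  eval (a ∷ p) x = a + x * eval p x

  infixl 6 _+ₚ_
  _+ₚ_ : Poly → Poly → Poly
  []      +ₚ q       = q
  (a ∷ p) +ₚ []      = a ∷ p
  (a ∷ p) +ₚ (b ∷ q) = a + b ∷ p +ₚ q

  infixl 7 _*ₚ_
  _*ₚ_ : Poly → Poly → Poly
  []      *ₚ q = []
  (a ∷ p) *ₚ q = map (a *_) q +ₚ (0# ∷ p *ₚ q)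

  1ₚ : Poly
  1ₚ = 1# ∷ []

  derivative : Poly → Poly
  derivative []      = []
  derivative (_ ∷ p) = weighted 1 p
    where
    weighted : ℕ → Poly → Poly
    weighted k []      = []
    weighted k (a ∷ p) = k · a ∷ weighted (suc k) p

  -- Meant for coefficients in a field, where coprimality of p with its
  -- derivative says that p has no repeated root in any extension.
  Separable : Poly → Set _
  Separable p = ∃[ u ] ∃[ v ] u *ₚ p +ₚ v *ₚ derivative p ≈ₚ 1ₚ

  Matrix : ℕ → Set c
  Matrix n = Fin n → Fin n → A

  det : ∀ {n} → Matrix n → A
  det {zero}  M = 1#
  det {suc n} M = sum λ j →
    (- 1#) ^ toℕ j * M zero j * det (λ r s → M (suc r) (punchIn j s))

  -- Here p and q have formal degrees m and n.
  -- Row by row, the coefficients of q, xq, …, xᵐ⁻¹q, p, xp, …, xⁿ⁻¹p,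
  -- with columns indexed by 1, x, …, xᵐ⁺ⁿ⁻¹.  This is the usual layout
  -- (rows xⁿ⁻¹p, …, p, xᵐ⁻¹q, …, q, leading coefficients first) rotated
  -- by a half turn, which does not change the determinant.
  sylvester : (m n : ℕ) → Poly → Poly → Matrix (m ℕ.+ n)
  sylvester m n p q i j = coeff (rows i) (toℕ j)
    where
    x^_∙_ : ℕ → Poly → Poly
    x^ k ∙ r = replicate k 0# ++ r

    rows : Vector.Vector Poly (m ℕ.+ n)
    rows = (λ (i : Fin m) → x^ toℕ i ∙ q) Vector.++ (λ (i : Fin n) → x^ toℕ i ∙ p)

  resultant : (m n : ℕ) → Poly → Poly → A
  resultant m n p q = det (sylvester m n p q)

  -- D = (-1)^(n(n-1)/2) aₙ⁻¹ Res(p , p′) for p of degree n with leading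
  -- coefficient aₙ.  The derivative is given the formal degree n - 1,
  -- as its actual degree may be smaller in positive characteristic.
  IsDiscriminant : ℕ → Poly → A → Set ℓ
  IsDiscriminant n p D =
    coeff p n * D ≈
    (- 1#) ^ (n ℕ.* pred n / 2) * resultant n (pred n) p (derivative p)

infix 4 _≡_[mod_]
record _≡_[mod_] (a b : ℤ) (q : ℕ) : Set where
  constructor congruent
  field
    q∣a-b : + q ∣ a ℤ.- b

-- Integers, with congruence modulo q as the equality.  This is the field
-- with q elements when q is prime.
ℤ/_ : ℕ → CommutativeRing 0ℓ 0ℓ
ℤ/ q = record
  { Carrier = ℤ
  ; _≈_     = _≡_[mod q ]
  ; _+_     = ℤ._+_
  ; _*_     = ℤ._*_
  ; -_      = ℤ.-_
  ; 0#      = 0ℤ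
  ; 1#      = 1ℤ
  ; isCommutativeRing = record
    { isRing = record
      { +-isAbelianGroup = record
        { isGroup = record
          { isMonoid = record
            { isSemigroup = record
              { isMagma = record
                { isEquivalence = record
                  { refl  = reflexive refl
                  ; sym   = λ {a} {b} → symmetric a b
                  ; trans = λ {a} {b} {c} → transitive a b c
                  }
                ; ∙-cong = λ {a} {b} {c} {d} → +-cong a b c d
                }
              ; assoc = λ a b c → reflexive (ℤ.+-assoc a b c)
              }
            ; identity = (λ a → reflexive (ℤ.+-identityˡ a))
                       , (λ a → reflexive (ℤ.+-identityʳ a))
            }
          ; inverse = (λ a → reflexive (ℤ.+-inverseˡ a))
                    , (λ a → reflexive (ℤ.+-inverseʳ a))
          ; ⁻¹-cong = λ {a} {b} → neg-cong a b
          }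
        ; comm = λ a b → reflexive (ℤ.+-comm a b)
        }
      ; *-cong     = λ {a} {b} {c} {d} → *-cong a b c d
      ; *-assoc    = λ a b c → reflexive (ℤ.*-assoc a b c)
      ; *-identity = (λ a → reflexive (ℤ.*-identityˡ a))
                   , (λ a → reflexive (ℤ.*-identityʳ a))
      ; distrib    = (λ a b c → reflexive (ℤ.*-distribˡ-+ a b c))
                   , (λ a b c → reflexive (ℤ.*-distribʳ-+ a b c))
      }
    ; *-comm = λ a b → reflexive (ℤ.*-comm a b)
    }
  }
  where
  infix 4 _~_
  _~_ : ℤ → ℤ → Set
  a ~ b = a ≡ b [mod q ]

  by : ∀ {a b x} → + q ∣ x → x ≡ a ℤ.- b → a ~ b
  by q∣x x≡a-b = congruent (subst (+ q ∣_) x≡a-b q∣x)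

  reflexive : ∀ {a b} → a ≡ b → a ~ b
  reflexive {a} refl = by (divides 0ℤ refl) (sym (ℤ.+-inverseʳ a))

  symmetric : ∀ a b → a ~ b → b ~ a
  symmetric a b (congruent h) = by (∣m⇒∣-m h) (lemma a b)
    where
    lemma : ∀ a b → ℤ.- (a ℤ.- b) ≡ b ℤ.- a
    lemma = solve-∀

  transitive : ∀ a b c → a ~ b → b ~ c → a ~ c
  transitive a b c (congruent h) (congruent k) =
    by (∣m∣n⇒∣m+n h k) (lemma a b c)
    where
    lemma : ∀ a b c → (a ℤ.- b) ℤ.+ (b ℤ.- c) ≡ a ℤ.- c
    lemma = solve-∀

  +-cong : ∀ a b c d → a ~ b → c ~ d → a ℤ.+ c ~ b ℤ.+ d
  +-cong a b c d (congruent h) (congruent k) =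
    by (∣m∣n⇒∣m+n h k) (lemma a b c d)
    where
    lemma : ∀ a b c d →
            (a ℤ.- b) ℤ.+ (c ℤ.- d) ≡ (a ℤ.+ c) ℤ.- (b ℤ.+ d)
    lemma = solve-∀

  neg-cong : ∀ a b → a ~ b → ℤ.- a ~ ℤ.- b
  neg-cong a b (congruent h) = by (∣m⇒∣-m h) (lemma a b)
    where
    lemma : ∀ a b → ℤ.- (a ℤ.- b) ≡ ℤ.- a ℤ.- (ℤ.- b)
    lemma = solve-∀

  *-cong : ∀ a b c d → a ~ b → c ~ d → a ℤ.* c ~ b ℤ.* d
  *-cong a b c d (congruent h) (congruent k) =
    by (∣m∣n⇒∣m+n (∣m⇒∣m*n c h) (∣n⇒∣m*n b k)) (lemma a b c d)
    where
    lemma : ∀ a b c d →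
            (a ℤ.- b) ℤ.* c ℤ.+ b ℤ.* (c ℤ.- d) ≡ a ℤ.* c ℤ.- b ℤ.* d
    lemma = solve-∀

module ℤ[x] = Polynomial ℤ.+-*-commutativeRing
module ℚ[x] = Polynomial ℚ.+-*-commutativeRing
module 𝔽[x] (q : ℕ) = Polynomial (ℤ/ q)

toℚ[x] : ℤ[x].Poly → ℚ[x].Poly
toℚ[x] = map fromℤ

-- The coefficients are unchanged; only their equality is coarser.
reduce : (q : ℕ) → ℤ[x].Poly → 𝔽[x].Poly q
reduce q f = f

Nonconstant : ℤ[x].Poly → Set
Nonconstant f = ∃[ n ] 0 < n × ℤ[x].HasDegree f n

Separable : ℤ[x].Poly → Set
Separable f = ℚ[x].Separable (toℚ[x] f)

_⟨_⟩ : ℤ[x].Poly → ℚ → ℚ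
f ⟨ r ⟩ = ℚ[x].eval (toℚ[x] f) r

record Squarefree (d : ℤ) : Set where
  field
    nonZero    : ℤ.NonZero d
    squarefree : ∀ k → k ℤ.* k ∣ d → k ∣ 1ℤ

record IsSquarefreePart (r : ℚ) (d : ℤ) : Set where
  field
    isSquarefree : Squarefree d

  instance
    d≢0 : ℤ.NonZero d
    d≢0 = Squarefree.nonZero isSquarefree

  field
    isSquare : ∃[ s ] r ÷ fromℤ d ≡ s ℚ.* s

𝒮 : ℤ[x].Poly → ℤ → Set
𝒮 f d = ∃[ r ] f ⟨ r ⟩ ≢ 0ℚ × IsSquarefreePart (f ⟨ r ⟩) d

-- The condition `sameDegree` makes the leading coefficient invertible
-- modulo the prime q, so `disc` is determined modulo q.
record Good (f : ℤ[x].Poly) (q : ℕ) : Set where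
  field
    isPrime        : Prime q
    isOdd          : q ≢ 2
    degree         : ℕ
    hasDegree      : ℤ[x].HasDegree f degree
    sameDegree     : 𝔽[x].HasDegree q (reduce q f) degree
    disc           : ℤ
    isDiscriminant : 𝔽[x].IsDiscriminant q degree (reduce q f) disc
    disc≢0         : ¬ (disc ≡ 0ℤ [mod q ])

HasRootModulo : ℤ[x].Poly → ℕ → Set
HasRootModulo f q = ∃[ a ] 𝔽[x].eval q (reduce q f) a ≡ 0ℤ [mod q ]

R : ℤ[x].Poly → ℕ → Set
R f q = Good f q × HasRootModulo f q

Infinite : (ℤ → Set) → Set
Infinite P = ∀ xs → ∃[ x ] P x × x ∉ xs

{-# OPTIONS --safe #-}

-- It suffices to find an integer a such that f(a) is divisible exactly once
-- by every q in T and by one further prime p, chosen larger than the absolute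
-- value of every member of a given finite list: all these primes then divide
-- the squarefree part of f(a), which is nonzero, so p keeps it off the list.
-- Schur's argument provides p, since f(b x) = b (1 + x c) for b = f(0), and as
-- p may avoid the integer combination of f and f′ obtained from separability,
-- f has only simple roots modulo p.  For a good q the same holds because a
-- common root x of f and f′ gives the vector (1, x, x², …) in the kernel of the
-- Sylvester matrix.  If a is a simple root modulo q, then q² cannot divide both
-- f(a) and f(a + q), and the Chinese remainder theorem combines the choices.
module Submission where

open import Defs
open import Algebra.Bundles using (CommutativeRing; NearSemiring)
open import Algebra.Morphism.Structures using (IsNearSemiringHomomorphism)
import Algebra.Solver.Ring.NaturalCoefficients.Default
open import Data.Fin.Base using (Fin; zero; suc; toℕ; punchIn; splitAt)
open import Data.Fin.Properties using (toℕ<n)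
open import Data.Integer.Base as ℤ using (ℤ; +_; 0ℤ; 1ℤ)
open import Data.Integer.Divisibility.Signed
  using (_∣_; _∣?_; divides; ∣ᵤ⇒∣; ∣⇒∣ᵤ; ∣-refl; ∣-trans; 0∣⇒≡0; m∣∣m∣; ∣m∣n⇒∣m+n;
         ∣m+n∣m⇒∣n; ∣m+n∣n⇒∣m; ∣m⇒∣m*n; ∣n⇒∣m*n; *-cancelˡ-∣)
import Data.Integer.Properties as ℤ
open import Data.Integer.Tactic.RingSolver using (solve-∀)
open import Data.List.Base using (List; []; _∷_; map; replicate; _++_; drop)
open import Data.List.Membership.Propositional using (_∈_)
open import Data.List.Properties using (map-id)
open import Data.List.Relation.Unary.All as All using (All; []; _∷_)
open import Data.List.Relation.Unary.Any using (here; there)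
open import Data.Nat.Base as ℕ using (ℕ; zero; suc; _≤_; _<_; z≤n; s≤s; _!)
open import Data.Nat.Coprimality using (Coprime; coprime-Bézout)
open import Data.Nat.DivMod using (_/_)
import Data.Nat.Divisibility as ℕ
open import Data.Nat.GCD using (module Bézout)
open import Data.Nat.Induction using (<-wellFounded)
import Data.Nat.ListAction as ℕ
open import Data.Nat.Primality
  using (Prime; ¬prime[0]; ¬prime[1]; prime[2]; prime⇒nonZero; prime⇒irreducible; euclidsLemma)
open import Data.Nat.Primality.Factorisation using (factorise)
import Data.Nat.Properties as ℕ
open import Data.Product.Base using (∃-syntax; _×_; _,_; proj₁; proj₂)
open import Data.Rational.Base as ℚ using (ℚ; 0ℚ)
open import Data.Rational.Literals using (fromℤ)
import Data.Rational.Properties as ℚ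
import Data.Rational.Unnormalised.Base as ℚᵘ
import Data.Rational.Unnormalised.Properties as ℚᵘ
open import Data.Sum.Base using (_⊎_; inj₁; inj₂; [_,_]′)
import Data.Vec.Functional as Vector
open import Function.Base using (_∘_; id)
open import Induction.WellFounded using (Acc; acc)
open import Relation.Binary.PropositionalEquality as ≡ using (_≡_; _≢_)
open import Relation.Nullary.Decidable using (yes; no; _×-dec_)
open import Relation.Nullary.Negation using (¬_; contradiction)

open import Data.List.Membership.DecPropositional ℕ._≟_ using (_∈?_)

module PolynomialProperties {c ℓ} (R : CommutativeRing c ℓ) where

  open CommutativeRing R renaming (Carrier to A) hiding (zero)
  open Polynomial R
  open import Algebra.Properties.Semiring.Sum semiring
    using (sum; sum-cong-≋; *-distribˡ-sum)
  open import Algebra.Properties.CommutativeMonoid.Sum +-commutativeMonoid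
    using (sum-remove; ∑-distrib-+)
  open import Algebra.Properties.Semiring.Exp semiring using (_^_)
  open import Algebra.Properties.Semiring.Mult semiring
    using (×-congʳ; ×-comm-*) renaming (_×_ to _·_)
  open import Algebra.Properties.CommutativeMonoid.Mult +-commutativeMonoid
    using (×-distrib-+)
  open import Algebra.Properties.Ring ring using (-1*x≈-x)
  open import Algebra.Properties.Group +-group using (⁻¹-involutive)
  open import Relation.Binary.Reasoning.Setoid setoid

  -- With natural coefficients the solver knows no negation, so signs are kept
  -- as factors - 1# below.
  module ℕ-Solver = Algebra.Solver.Ring.NaturalCoefficients.Default commutativeSemiring
  open ℕ-Solver using (solve; _:=_; _:+_; _:*_; con)

  -- The local function in the definition of derivative cannot be named from
  -- outside; unification recovers it from the equation weighted-spec, once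
  -- its arguments have been abstracted to distinct variables.
  mutual
    weighted : A → Poly → ℕ → Poly → Poly
    weighted = _

    weighted-spec : ∀ a b p →
      drop 1 (derivative (a ∷ b ∷ p)) ≡ weighted a (b ∷ p) 2 p
    weighted-spec a b p with b ∷ p | 2
    ... | q | k = ≡.refl

  sgn : ∀ {n} → Fin n → A
  sgn i = (- 1#) ^ toℕ i

  sum-cong : ∀ {n} (t u : Fin n → A) → (∀ i → t i ≈ u i) → sum t ≈ sum u
  sum-cong t u = sum-cong-≋

  det-cong : ∀ {n} (M N : Matrix n) → (∀ i j → M i j ≈ N i j) → det M ≈ det N
  det-cong {zero}  M N M≈N = refl
  det-cong {suc n} M N M≈N = sum-cong {suc n} _ _ λ j →
    *-cong (*-congˡ {sgn j} (M≈N zero j)) (det-cong _ _ λ r s → M≈N (suc r) (punchIn j s))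

  -1*-1≈1 : - 1# * - 1# ≈ 1#
  -1*-1≈1 = trans (-1*x≈-x (- 1#)) (⁻¹-involutive 1#)

  sgn*sgn≈1 : ∀ {n} (i : Fin n) → sgn i * sgn i ≈ 1#
  sgn*sgn≈1 zero    = *-identityˡ 1#
  sgn*sgn≈1 (suc i) = begin
    (- 1# * sgn i) * (- 1# * sgn i) ≈⟨ solve 2 (λ e s → (e :* s) :* (e :* s) := (e :* e) :* (s :* s)) refl (- 1#) (sgn i) ⟩
    (- 1# * - 1#) * (sgn i * sgn i) ≈⟨ *-cong -1*-1≈1 (sgn*sgn≈1 i) ⟩
    1# * 1#                         ≈⟨ *-identityˡ 1# ⟩
    1#                              ∎

  punchIn-exchange : ∀ {n} (j : Fin (suc (suc n))) (k : Fin (suc n)) → ∃[ l ]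
    punchIn (punchIn j k) l ≡ j ×
    (∀ s → punchIn (punchIn j k) (punchIn l s) ≡ punchIn j (punchIn k s)) ×
    sgn j * sgn (punchIn j k) ≈ sgn (suc k) * sgn l
  punchIn-exchange zero k = zero , ≡.refl , (λ s → ≡.refl) , *-comm 1# (sgn (suc k))
  punchIn-exchange (suc j) zero = j , ≡.refl , (λ s → ≡.refl) ,
    solve 2 (λ e s → (e :* s) :* con 1 := (e :* con 1) :* s) refl (- 1#) (sgn j)
  punchIn-exchange {suc n} (suc j) (suc k) with punchIn-exchange j k
  ... | l , eq , eqs , sgn-eq =
    suc l , ≡.cong suc eq , (λ { zero → ≡.refl ; (suc s) → ≡.cong suc (eqs s) }) , (begin
      (- 1# * sgn j) * (- 1# * sgn (punchIn j k))
        ≈⟨ solve 3 (λ e s t → (e :* s) :* (e :* t) := (e :* e) :* (s :* t)) refl (- 1#) (sgn j) _ ⟩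
      (- 1# * - 1#) * (sgn j * sgn (punchIn j k))
        ≈⟨ *-congˡ sgn-eq ⟩
      (- 1# * - 1#) * (sgn (suc k) * sgn l)
        ≈⟨ solve 3 (λ e s t → (e :* e) :* (s :* t) := (e :* s) :* (e :* t)) refl (- 1#) (sgn (suc k)) (sgn l) ⟩
      (- 1# * sgn (suc k)) * (- 1# * sgn l) ∎)

  infixr 5 _◂_
  _◂_ : ∀ {m n} → (Fin m → A) → (Fin m → Fin n → A) → Fin m → Fin (suc n) → A
  (c ◂ M) i = c i Vector.∷ M i

  minor : ∀ {m n} → Fin (suc n) → (Fin (suc m) → Fin (suc n) → A) → Fin m → Fin n → A
  minor j M r s = M (suc r) (punchIn j s)

  det-◂-cong : ∀ {n} (c d : Fin (suc n) → A) M N →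
    (∀ i → c i ≈ d i) → (∀ i j → M i j ≈ N i j) → det (c ◂ M) ≈ det (d ◂ N)
  det-◂-cong c d M N c≈d M≈N = det-cong (c ◂ M) (d ◂ N) λ
    { i zero → c≈d i ; i (suc j) → M≈N i j }

  det-◂ : ∀ {n} (c : Fin (suc (suc n)) → A) M →
    det (c ◂ M) ≈ c zero * det (λ r → M (suc r)) +
      sum λ k → sgn (suc k) * M zero k * det ((λ r → c (suc r)) ◂ minor k M)
  det-◂ c M = +-cong (*-congʳ (*-identityˡ (c zero)))
    (sum-cong {suc _} _ _ λ k → *-congˡ {sgn (suc k) * M zero k} (det-cong (minor (suc k) (c ◂ M)) ((λ r → c (suc r)) ◂ minor k M)
      λ { r zero → refl ; r (suc s) → refl }))

  det-◂-linear : ∀ {n} x (c d : Fin (suc n) → A) M →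
    det ((λ i → c i + x * d i) ◂ M) ≈ det (c ◂ M) + x * det (d ◂ M)
  det-◂-linear {zero} x c d M =
    solve 3 (λ x c d → con 1 :* (c :+ x :* d) :* con 1 :+ con 0
      := (con 1 :* c :* con 1 :+ con 0) :+ x :* (con 1 :* d :* con 1 :+ con 0)) refl x (c zero) (d zero)
  det-◂-linear {suc n} x c d M = begin
    det ((λ i → c i + x * d i) ◂ M)
      ≈⟨ det-◂ (λ i → c i + x * d i) M ⟩
    (c zero + x * d zero) * D + sum (λ k → a k * det ((λ r → c (suc r) + x * d (suc r)) ◂ minor k M))
      ≈⟨ +-congˡ (sum-cong {suc n} _ _ λ k → trans (*-congˡ (det-◂-linear x (λ r → c (suc r)) (λ r → d (suc r)) (minor k M)))
           (solve 4 (λ a u x v → a :* (u :+ x :* v) := a :* u :+ x :* (a :* v)) refl (a k) (C k) x (E k))) ⟩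
    (c zero + x * d zero) * D + sum (λ k → a k * C k + x * (a k * E k))
      ≈⟨ +-congˡ (trans (∑-distrib-+ {suc n} (λ k → a k * C k) (λ k → x * (a k * E k))) (+-congˡ (sym (*-distribˡ-sum x (λ k → a k * E k))))) ⟩
    (c zero + x * d zero) * D + (sum (λ k → a k * C k) + x * sum (λ k → a k * E k))
      ≈⟨ solve 6 (λ c x d D u v → (c :+ x :* d) :* D :+ (u :+ x :* v) := (c :* D :+ u) :+ x :* (d :* D :+ v))
           refl (c zero) x (d zero) D _ _ ⟩
    (c zero * D + sum (λ k → a k * C k)) + x * (d zero * D + sum (λ k → a k * E k))
      ≈⟨ +-cong (det-◂ c M) (*-congˡ (det-◂ d M)) ⟨
    det (c ◂ M) + x * det (d ◂ M) ∎
    where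
    D = det (λ r → M (suc r))
    a C E : Fin (suc n) → A
    a k = sgn (suc k) * M zero k
    C k = det ((λ r → c (suc r)) ◂ minor k M)
    E k = det ((λ r → d (suc r)) ◂ minor k M)

  det-moveToFront : ∀ {n} (M : Matrix (suc n)) j →
    det ((λ i → M i j) ◂ (λ i s → M i (punchIn j s))) ≈ sgn j * det M
  det-moveToFront {zero} M zero = trans (det-cong ((λ i → M i zero) ◂ λ i s → M i (punchIn zero s)) M λ { i zero → refl }) (sym (*-identityˡ _))
  det-moveToFront {suc n} M j = begin
    det ((λ i → M i j) ◂ (λ i s → M i (punchIn j s)))
      ≈⟨ det-◂ (λ i → M i j) (λ i s → M i (punchIn j s)) ⟩
    M zero j * det (minor j M) + sum (λ k → sgn (suc k) * M zero (punchIn j k) *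
      det ((λ r → M (suc r) j) ◂ λ r s → M (suc r) (punchIn j (punchIn k s))))
      ≈⟨ +-cong at-j (sum-cong {suc n} _ _ at-punchIn) ⟩
    sgn j * t j + sum (λ k → sgn j * t (punchIn j k))
      ≈⟨ +-congˡ (*-distribˡ-sum (sgn j) (λ k → t (punchIn j k))) ⟨
    sgn j * t j + sgn j * sum (λ k → t (punchIn j k))
      ≈⟨ distribˡ (sgn j) _ _ ⟨
    sgn j * (t j + sum (λ k → t (punchIn j k)))
      ≈⟨ *-congˡ (sum-remove t) ⟨
    sgn j * det M ∎
    where
    t : Fin (suc (suc n)) → A
    t i = sgn i * M zero i * det (minor i M)

    at-j : M zero j * det (minor j M) ≈ sgn j * t j
    at-j = begin
      M zero j * det (minor j M)                     ≈⟨ *-identityˡ _ ⟨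
      1# * (M zero j * det (minor j M))              ≈⟨ *-congʳ (sgn*sgn≈1 j) ⟨
      (sgn j * sgn j) * (M zero j * det (minor j M)) ≈⟨ solve 3 (λ s m d → (s :* s) :* (m :* d) := s :* (s :* m :* d)) refl (sgn j) (M zero j) _ ⟩
      sgn j * t j                                    ∎

    at-punchIn : ∀ k → sgn (suc k) * M zero (punchIn j k) *
      det ((λ r → M (suc r) j) ◂ λ r s → M (suc r) (punchIn j (punchIn k s))) ≈ sgn j * t (punchIn j k)
    at-punchIn k with punchIn-exchange j k
    ... | l , eq , eqs , sgn-eq = begin
      sgn (suc k) * m * det ((λ r → M (suc r) j) ◂ λ r s → M (suc r) (punchIn j (punchIn k s)))
        ≈⟨ *-congˡ (det-◂-cong (λ r → minor p M r l) (λ r → M (suc r) j) (λ r s → minor p M r (punchIn l s)) _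
             (λ r → reflexive (≡.cong (M (suc r)) eq))
             (λ r s → reflexive (≡.cong (M (suc r)) (eqs s)))) ⟨
      sgn (suc k) * m * det ((λ r → minor p M r l) ◂ λ r s → minor p M r (punchIn l s))
        ≈⟨ *-congˡ (det-moveToFront (minor p M) l) ⟩
      sgn (suc k) * m * (sgn l * det (minor p M))
        ≈⟨ solve 4 (λ s m u d → s :* m :* (u :* d) := (s :* u) :* (m :* d)) refl (sgn (suc k)) m (sgn l) _ ⟩
      (sgn (suc k) * sgn l) * (m * det (minor p M))
        ≈⟨ *-congʳ sgn-eq ⟨
      (sgn j * sgn p) * (m * det (minor p M))
        ≈⟨ solve 4 (λ s m u d → (s :* u) :* (m :* d) := s :* (u :* m :* d)) refl (sgn j) m (sgn p) _ ⟩
      sgn j * t p ∎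
      where
      p = punchIn j k
      m = M zero p

  infix 7 _∙_
  _∙_ : ∀ {n} → (Fin n → A) → (Fin n → A) → A
  u ∙ v = sum λ j → u j * v j

  det-combine-columns : ∀ {n} (M : Matrix (suc n)) v →
    det ((λ i → M i ∙ v) ◂ λ i s → M i (suc s)) ≈ v zero * det M
  det-combine-columns {zero} M v =
    solve 2 (λ m v → con 1 :* (m :* v :+ con 0) :* con 1 :+ con 0 := v :* (con 1 :* m :* con 1 :+ con 0))
      refl (M zero zero) (v zero)
  det-combine-columns {suc n} M v = begin
    det ((λ i → M i ∙ v) ◂ λ i s → M i (suc s))
      ≈⟨ det-◂ (λ i → M i ∙ v) (λ i s → M i (suc s)) ⟩
    (M zero ∙ v) * D + sum (λ k → sgn (suc k) * m k * det ((λ r → M (suc r) ∙ v) ◂ N k))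
      ≈⟨ +-congˡ (sum-cong {suc n} _ _ summand) ⟩
    (M zero ∙ v) * D + sum (λ k → v zero * u k + - 1# * D * (m k * v (suc k)))
      ≈⟨ +-congˡ (∑-distrib-+ {suc n} (λ k → v zero * u k) (λ k → - 1# * D * (m k * v (suc k)))) ⟩
    (M zero ∙ v) * D + (sum (λ k → v zero * u k) + sum (λ k → - 1# * D * (m k * v (suc k))))
      ≈⟨ +-congˡ (+-cong (*-distribˡ-sum (v zero) u) (*-distribˡ-sum (- 1# * D) (λ k → m k * v (suc k)))) ⟨
    (M zero zero * v zero + S) * D + (v zero * sum u + - 1# * D * S)
      ≈⟨ solve 6 (λ m v s d u e → (m :* v :+ s) :* d :+ (v :* u :+ e :* d :* s)
           := v :* (con 1 :* m :* d :+ u) :+ (s :* d :+ e :* (s :* d)))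
           refl (M zero zero) (v zero) S D (sum u) (- 1#) ⟩
    v zero * det M + (S * D + - 1# * (S * D))
      ≈⟨ +-congˡ (trans (+-congˡ (-1*x≈-x (S * D))) (-‿inverseʳ (S * D))) ⟩
    v zero * det M + 0#
      ≈⟨ +-identityʳ _ ⟩
    v zero * det M ∎
    where
    D = det (minor zero M)

    m u : Fin (suc n) → A
    m k = M zero (suc k)
    u k = sgn (suc k) * m k * det (minor (suc k) M)

    S = sum λ k → m k * v (suc k)

    N : Fin (suc n) → Fin (suc n) → Fin n → A
    N k r s = M (suc r) (suc (punchIn k s))

    v′ : Fin (suc n) → Fin (suc n) → A
    v′ k s = v (punchIn (suc k) s)

    summand : ∀ k → sgn (suc k) * m k * det ((λ r → M (suc r) ∙ v) ◂ N k) ≈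
              v zero * u k + - 1# * D * (m k * v (suc k))
    summand k = begin
      sgn (suc k) * m k * det ((λ r → M (suc r) ∙ v) ◂ N k)
        ≈⟨ *-congˡ (det-◂-cong (λ r → M (suc r) ∙ v) _ (N k) (N k)
             (λ r → trans (sum-remove {i = suc k} (λ j → M (suc r) j * v j)) (trans (+-comm _ _)
               (+-congˡ {minor (suc k) M r ∙ v′ k} (*-comm (M (suc r) (suc k)) (v (suc k)))))) (λ r s → refl)) ⟩
      sgn (suc k) * m k * det ((λ r → minor (suc k) M r ∙ v′ k + v (suc k) * M (suc r) (suc k)) ◂ N k)
        ≈⟨ *-congˡ (det-◂-linear (v (suc k)) (λ r → minor (suc k) M r ∙ v′ k) (λ r → M (suc r) (suc k)) (N k)) ⟩
      sgn (suc k) * m k * (det ((λ r → minor (suc k) M r ∙ v′ k) ◂ N k) +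
        v (suc k) * det ((λ r → M (suc r) (suc k)) ◂ N k))
        ≈⟨ *-congˡ (+-cong (det-combine-columns (minor (suc k) M) (v′ k))
             (*-congˡ (det-moveToFront (minor zero M) k))) ⟩
      (- 1# * sgn k) * m k * (v zero * det (minor (suc k) M) + v (suc k) * (sgn k * D))
        ≈⟨ solve 7 (λ e s m v d w D → (e :* s) :* m :* (v :* d :+ w :* (s :* D))
             := v :* ((e :* s) :* m :* d) :+ (s :* s) :* (e :* D :* (m :* w)))
             refl (- 1#) (sgn k) (m k) (v zero) _ (v (suc k)) D ⟩
      v zero * u k + (sgn k * sgn k) * (- 1# * D * (m k * v (suc k)))
        ≈⟨ +-congˡ (trans (*-congʳ (sgn*sgn≈1 k)) (*-identityˡ _)) ⟩
      v zero * u k + - 1# * D * (m k * v (suc k)) ∎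

  kernel⇒det≈0 : ∀ {n} (M : Matrix (suc n)) v → v zero ≈ 1# → (∀ i → M i ∙ v ≈ 0#) → det M ≈ 0#
  kernel⇒det≈0 M v v₀≈1 Mv≈0 = begin
    det M
      ≈⟨ *-identityˡ _ ⟨
    1# * det M
      ≈⟨ *-congʳ v₀≈1 ⟨
    v zero * det M
      ≈⟨ det-combine-columns M v ⟨
    det ((λ i → M i ∙ v) ◂ N)
      ≈⟨ det-◂-cong (λ i → M i ∙ v) (λ i → 0# + - 1# * 0#) N N
           (λ i → trans (Mv≈0 i) (sym (trans (+-identityˡ _) (zeroʳ (- 1#))))) (λ r s → refl) ⟩
    det ((λ i → 0# + - 1# * 0#) ◂ N)
      ≈⟨ det-◂-linear (- 1#) (λ _ → 0#) (λ _ → 0#) N ⟩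
    det ((λ _ → 0#) ◂ N) + - 1# * det ((λ _ → 0#) ◂ N)
      ≈⟨ trans (+-congˡ (-1*x≈-x _)) (-‿inverseʳ _) ⟩
    0# ∎
    where
    N : ∀ r s → A
    N r s = M r (suc s)

  ·-zeroʳ : ∀ n → n · 0# ≈ 0#
  ·-zeroʳ zero    = refl
  ·-zeroʳ (suc n) = trans (+-identityˡ _) (·-zeroʳ n)

  eval-weighted : ∀ a q k p x →
    eval (weighted a q k p) x ≈ k · eval p x + x * eval (derivative p) x
  eval-weighted a q k []      x = sym (trans (+-cong (·-zeroʳ k) (zeroʳ x)) (+-identityˡ 0#))
  eval-weighted a q k (b ∷ p) x = begin
    k · b + x * eval (weighted a q (suc k) p) x
      ≈⟨ +-congˡ (*-congˡ (eval-weighted a q (suc k) p x)) ⟩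
    k · b + x * ((e + k · e) + x * d)
      ≈⟨ solve 5 (λ kb x e ke d → kb :+ x :* ((e :+ ke) :+ x :* d)
           := (kb :+ x :* ke) :+ x :* (e :+ con 0 :+ x :* d)) refl (k · b) x e (k · e) d ⟩
    (k · b + x * (k · e)) + x * (1 · e + x * d)
      ≈⟨ +-cong (+-congˡ (sym (×-comm-* k x e))) (*-congˡ (eval-weighted b p 1 p x)) ⟨
    (k · b + k · (x * e)) + x * eval (weighted b p 1 p) x
      ≈⟨ +-congʳ (×-distrib-+ b (x * e) k) ⟨
    k · (b + x * e) + x * eval (weighted b p 1 p) x ∎
    where
    e = eval p x
    d = eval (derivative p) x

  eval-derivative : ∀ a p x → eval (derivative (a ∷ p)) x ≈ eval p x + x * eval (derivative p) x
  eval-derivative a p x = trans (eval-weighted a p 1 p x) (+-congʳ (+-identityʳ _))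

  coeff-weighted : ∀ a q k p i → coeff (weighted a q k p) i ≈ (k ℕ.+ i) · coeff p i
  coeff-weighted a q k []      i       = sym (·-zeroʳ (k ℕ.+ i))
  coeff-weighted a q k (b ∷ p) zero    = reflexive (≡.cong (_· b) (≡.sym (ℕ.+-identityʳ k)))
  coeff-weighted a q k (b ∷ p) (suc i) = trans (coeff-weighted a q (suc k) p i)
    (reflexive (≡.cong (_· coeff p i) (≡.sym (ℕ.+-suc k i))))

  coeff-derivative : ∀ p i → coeff (derivative p) i ≈ suc i · coeff p (suc i)
  coeff-derivative []      i = sym (·-zeroʳ (suc i))
  coeff-derivative (a ∷ p) i = coeff-weighted a p 1 p i

  VanishesFrom : ℕ → Poly → Set ℓ
  VanishesFrom n p = ∀ i → n ≤ i → coeff p i ≈ 0#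

  derivative-vanishesFrom : ∀ {n} p → VanishesFrom (suc n) p → VanishesFrom n (derivative p)
  derivative-vanishesFrom p p≈0 i n≤i = trans (coeff-derivative p i)
    (trans (×-congʳ (suc i) (p≈0 (suc i) (s≤s n≤i))) (·-zeroʳ (suc i)))

  shift-vanishesFrom : ∀ k {n} p → VanishesFrom n p → VanishesFrom (k ℕ.+ n) (replicate k 0# ++ p)
  shift-vanishesFrom zero    p p≈0 i       n≤i         = p≈0 i n≤i
  shift-vanishesFrom (suc k) p p≈0 (suc i) (s≤s k+n≤i) = shift-vanishesFrom k p p≈0 i k+n≤i

  eval-shift : ∀ k p {x} → eval p x ≈ 0# → eval (replicate k 0# ++ p) x ≈ 0#
  eval-shift zero    p     px≈0 = px≈0
  eval-shift (suc k) p {x} px≈0 =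
    trans (+-identityˡ _) (trans (*-congˡ (eval-shift k p px≈0)) (zeroʳ x))

  eval-vanishing : ∀ p x → VanishesFrom 0 p → eval p x ≈ 0#
  eval-vanishing []      x p≈0 = refl
  eval-vanishing (a ∷ p) x p≈0 = trans
    (+-cong (p≈0 0 z≤n) (trans (*-congˡ (eval-vanishing p x λ i _ → p≈0 (suc i) z≤n)) (zeroʳ x)))
    (+-identityˡ 0#)

  powers : ∀ n → A → Fin n → A
  powers n x j = x ^ toℕ j

  coeff-∙-powers : ∀ n p x → VanishesFrom n p → (λ (j : Fin n) → coeff p (toℕ j)) ∙ powers n x ≈ eval p x
  coeff-∙-powers zero    p       x p≈0 = sym (eval-vanishing p x p≈0)
  coeff-∙-powers (suc n) []      x p≈0 =
    trans (sym (*-distribˡ-sum 0# (powers (suc n) x))) (zeroˡ (sum (powers (suc n) x)))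
  coeff-∙-powers (suc n) (a ∷ p) x p≈0 = +-cong (*-identityʳ a) (begin
    sum (λ (j : Fin n) → coeff p (toℕ j) * (x * x ^ toℕ j))
      ≈⟨ sum-cong {n} _ _ (λ j → solve 3 (λ c x y → c :* (x :* y) := x :* (c :* y)) refl (coeff p (toℕ j)) x _) ⟩
    sum (λ (j : Fin n) → x * (coeff p (toℕ j) * x ^ toℕ j))
      ≈⟨ *-distribˡ-sum x (λ (j : Fin n) → coeff p (toℕ j) * x ^ toℕ j) ⟨
    x * sum (λ (j : Fin n) → coeff p (toℕ j) * x ^ toℕ j)
      ≈⟨ *-congˡ (coeff-∙-powers n p x λ i n≤i → p≈0 (suc i) (s≤s n≤i)) ⟩
    x * eval p x ∎)

  sylvester-row : ∀ m n p q {x} →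
    VanishesFrom (suc m) p → VanishesFrom (suc n) q → eval p x ≈ 0# → eval q x ≈ 0# →
    ∀ i → ∃[ r ] (∀ j → sylvester m n p q i j ≡ coeff r (toℕ j)) ×
                 VanishesFrom (m ℕ.+ n) r × eval r x ≈ 0#
  sylvester-row m n p q p≈0 q≈0 px≈0 qx≈0 i with splitAt m i
  ... | inj₁ k = replicate (toℕ k) 0# ++ q , (λ j → ≡.refl) , (λ l m+n≤l → shift-vanishesFrom (toℕ k) q q≈0 l (ℕ.≤-trans
    (ℕ.≤-trans (ℕ.≤-reflexive (ℕ.+-suc (toℕ k) n)) (ℕ.+-monoˡ-≤ n (toℕ<n k))) m+n≤l)) ,
    eval-shift (toℕ k) q qx≈0
  ... | inj₂ k = replicate (toℕ k) 0# ++ p , (λ j → ≡.refl) , (λ l m+n≤l → shift-vanishesFrom (toℕ k) p p≈0 l (ℕ.≤-trans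
    (ℕ.≤-trans (ℕ.≤-reflexive (ℕ.+-suc (toℕ k) m)) (ℕ.≤-trans (ℕ.+-monoˡ-≤ m (toℕ<n k))
      (ℕ.≤-reflexive (ℕ.+-comm n m)))) m+n≤l)) ,
    eval-shift (toℕ k) p px≈0

  commonRoot⇒resultant≈0 : ∀ m n p q x →
    VanishesFrom (suc (suc m)) p → VanishesFrom (suc n) q → eval p x ≈ 0# → eval q x ≈ 0# →
    resultant (suc m) n p q ≈ 0#
  commonRoot⇒resultant≈0 m n p q x p≈0 q≈0 px≈0 qx≈0 =
    kernel⇒det≈0 (sylvester (suc m) n p q) (powers _ x) refl row
    where
    row : ∀ i → sylvester (suc m) n p q i ∙ powers _ x ≈ 0#
    row i with sylvester-row (suc m) n p q p≈0 q≈0 px≈0 qx≈0 i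
    ... | r , eq , r≈0 , rx≈0 = trans
      (sum-cong {suc m ℕ.+ n} _ _ λ j → *-congʳ {x ^ toℕ j} (reflexive (eq j)))
      (trans (coeff-∙-powers (suc m ℕ.+ n) r x r≈0) rx≈0)

  multipleRoot⇒disc≈0 : ∀ m p D x → VanishesFrom (suc (suc m)) p → IsDiscriminant (suc m) p D →
    eval p x ≈ 0# → eval (derivative p) x ≈ 0# → coeff p (suc m) * D ≈ 0#
  multipleRoot⇒disc≈0 m p D x p≈0 isDisc px≈0 p′x≈0 = trans isDisc (trans
    (*-congˡ {(- 1#) ^ (suc m ℕ.* m / 2)}
      (commonRoot⇒resultant≈0 m m p (derivative p) x p≈0 (derivative-vanishesFrom p p≈0) px≈0 p′x≈0))
    (zeroʳ _))

  eval-cong : ∀ p q x → p ≈ₚ q → eval p x ≈ eval q x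
  eval-cong []      q       x p≈q = sym (eval-vanishing q x λ i _ → sym (p≈q i))
  eval-cong (a ∷ p) []      x p≈q = eval-vanishing (a ∷ p) x λ i _ → p≈q i
  eval-cong (a ∷ p) (b ∷ q) x p≈q = +-cong (p≈q 0) (*-congˡ (eval-cong p q x λ i → p≈q (suc i)))

  eval-+ₚ : ∀ p q x → eval (p +ₚ q) x ≈ eval p x + eval q x
  eval-+ₚ []      q       x = sym (+-identityˡ _)
  eval-+ₚ (a ∷ p) []      x = sym (+-identityʳ _)
  eval-+ₚ (a ∷ p) (b ∷ q) x = trans (+-congˡ (*-congˡ (eval-+ₚ p q x)))
    (solve 5 (λ a b x u v → (a :+ b) :+ x :* (u :+ v) := (a :+ x :* u) :+ (b :+ x :* v))
      refl a b x (eval p x) (eval q x))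

  eval-scale : ∀ a p x → eval (map (a *_) p) x ≈ a * eval p x
  eval-scale a []      x = sym (zeroʳ a)
  eval-scale a (b ∷ p) x = trans (+-congˡ (*-congˡ (eval-scale a p x)))
    (solve 4 (λ a b x u → a :* b :+ x :* (a :* u) := a :* (b :+ x :* u)) refl a b x (eval p x))

  eval-*ₚ : ∀ p q x → eval (p *ₚ q) x ≈ eval p x * eval q x
  eval-*ₚ []      q x = sym (zeroˡ _)
  eval-*ₚ (a ∷ p) q x = begin
    eval (map (a *_) q +ₚ (0# ∷ p *ₚ q)) x
      ≈⟨ eval-+ₚ (map (a *_) q) _ x ⟩
    eval (map (a *_) q) x + (0# + x * eval (p *ₚ q) x)
      ≈⟨ +-cong (eval-scale a q x) (+-congˡ (*-congˡ (eval-*ₚ p q x))) ⟩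
    a * eval q x + (0# + x * (eval p x * eval q x))
      ≈⟨ solve 4 (λ a x u v → a :* v :+ (con 0 :+ x :* (u :* v)) := (a :+ x :* u) :* v)
           refl a x (eval p x) (eval q x) ⟩
    (a + x * eval p x) * eval q x ∎

open ≡ using (refl; sym; trans; cong; cong₂; subst; module ≡-Reasoning)

module _ {c₁ ℓ₁ c₂ ℓ₂} (R : CommutativeRing c₁ ℓ₁) (S : CommutativeRing c₂ ℓ₂) where

  private
    module R = CommutativeRing R
    module S = CommutativeRing S
    module R[x] where
      open Polynomial R public
      open PolynomialProperties R public
    module S[x] where
      open Polynomial S public
      open PolynomialProperties S public

  module _ {φ : R.Carrier → S.Carrier}
    (isHom : IsNearSemiringHomomorphism
      (NearSemiring.rawNearSemiring (CommutativeRing.nearSemiring R))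
      (NearSemiring.rawNearSemiring (CommutativeRing.nearSemiring S)) φ) where

    open IsNearSemiringHomomorphism isHom

    eval-map : ∀ p x → S[x].eval (map φ p) (φ x) S.≈ φ (R[x].eval p x)
    eval-map []      x = S.sym 0#-homo
    eval-map (a ∷ p) x = S.trans (S.+-congˡ (S.*-congˡ (eval-map p x)))
      (S.trans (S.+-congˡ (S.sym (*-homo x _))) (S.sym (+-homo a _)))

    eval-derivative-map : ∀ p x →
      S[x].eval (S[x].derivative (map φ p)) (φ x) S.≈ φ (R[x].eval (R[x].derivative p) x)
    eval-derivative-map []      x = S.sym 0#-homo
    eval-derivative-map (a ∷ p) x =
      S.trans (S[x].eval-derivative (φ a) (map φ p) (φ x))
      (S.trans (S.+-cong (eval-map p x) (S.*-congˡ (eval-derivative-map p x)))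
      (S.trans (S.+-congˡ (S.sym (*-homo x _)))
      (S.trans (S.sym (+-homo _ _)) (⟦⟧-cong (R.sym (R[x].eval-derivative a p x))))))

ev ev′ : ℤ[x].Poly → ℤ → ℤ
ev  f a = ℤ[x].eval f a
ev′ f a = ℤ[x].eval (ℤ[x].derivative f) a

ev′-∷ : ∀ b f a → ev′ (b ∷ f) a ≡ ev f a ℤ.+ a ℤ.* ev′ f a
ev′-∷ = PolynomialProperties.eval-derivative ℤ.+-*-commutativeRing

fromℤ-+ : ∀ i j → fromℤ (i ℤ.+ j) ≡ fromℤ i ℚ.+ fromℤ j
fromℤ-+ i j = ℚ.toℚᵘ-injective (ℚᵘ.≃-trans (ℚᵘ.*≡* (lemma i j)) (ℚᵘ.≃-sym (ℚ.toℚᵘ-homo-+ (fromℤ i) (fromℤ j))))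
  where
  lemma : ∀ i j → (i ℤ.+ j) ℤ.* 1ℤ ≡ (i ℤ.* 1ℤ ℤ.+ j ℤ.* 1ℤ) ℤ.* 1ℤ
  lemma = solve-∀

fromℤ-* : ∀ i j → fromℤ (i ℤ.* j) ≡ fromℤ i ℚ.* fromℤ j
fromℤ-* i j = ℚ.toℚᵘ-injective (ℚᵘ.≃-sym (ℚ.toℚᵘ-homo-* (fromℤ i) (fromℤ j)))

fromℤ-injective : ∀ {i j} → fromℤ i ≡ fromℤ j → i ≡ j
fromℤ-injective = cong ℚ.numerator

fromℤ-isHom : IsNearSemiringHomomorphism
  (NearSemiring.rawNearSemiring (CommutativeRing.nearSemiring ℤ.+-*-commutativeRing))
  (NearSemiring.rawNearSemiring (CommutativeRing.nearSemiring ℚ.+-*-commutativeRing)) fromℤ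
fromℤ-isHom = record
  { +-isMonoidHomomorphism = record
    { isMagmaHomomorphism = record
      { isRelHomomorphism = record { cong = cong fromℤ }
      ; homo = fromℤ-+
      }
    ; ε-homo = refl
    }
  ; *-homo = fromℤ-*
  }

module _ {q : ℕ} where
  private module 𝔽 = CommutativeRing (ℤ/ q)

  reduction-isHom : IsNearSemiringHomomorphism
    (NearSemiring.rawNearSemiring (CommutativeRing.nearSemiring ℤ.+-*-commutativeRing))
    (NearSemiring.rawNearSemiring (CommutativeRing.nearSemiring (ℤ/ q))) id
  reduction-isHom = record
    { +-isMonoidHomomorphism = record
      { isMagmaHomomorphism = record
        { isRelHomomorphism = record { cong = 𝔽.reflexive }
        ; homo = λ _ _ → 𝔽.refl
        }
      ; ε-homo = 𝔽.refl
      }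
    ; *-homo = λ _ _ → 𝔽.refl
    }

  eval-reduce : ∀ f a → 𝔽[x].eval q (reduce q f) a ≡ ev f a [mod q ]
  eval-reduce f a = subst (λ g → 𝔽[x].eval q g a ≡ ev f a [mod q ]) (map-id f)
    (eval-map ℤ.+-*-commutativeRing (ℤ/ q) reduction-isHom f a)

  eval-derivative-reduce : ∀ f a →
    𝔽[x].eval q (𝔽[x].derivative q (reduce q f)) a ≡ ev′ f a [mod q ]
  eval-derivative-reduce f a = subst (λ g → 𝔽[x].eval q (𝔽[x].derivative q g) a ≡ ev′ f a [mod q ]) (map-id f)
    (eval-derivative-map ℤ.+-*-commutativeRing (ℤ/ q) reduction-isHom f a)

  ∣⇒≡0 : ∀ {a} → + q ∣ a → a ≡ 0ℤ [mod q ]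
  ∣⇒≡0 {a} q∣a = congruent (subst (+ q ∣_) (sym (ℤ.+-identityʳ a)) q∣a)

  ≡0⇒∣ : ∀ {a} → a ≡ 0ℤ [mod q ] → + q ∣ a
  ≡0⇒∣ {a} (congruent q∣a-0) = subst (+ q ∣_) (ℤ.+-identityʳ a) q∣a-0

prime∣*⇒∣⊎∣ : ∀ {p} → Prime p → ∀ x y → + p ∣ x ℤ.* y → + p ∣ x ⊎ + p ∣ y
prime∣*⇒∣⊎∣ {p} pr x y p∣xy
  with euclidsLemma ℤ.∣ x ∣ ℤ.∣ y ∣ pr (subst (p ℕ.∣_) (ℤ.abs-* x y) (∣⇒∣ᵤ p∣xy))
... | inj₁ h = inj₁ (∣ᵤ⇒∣ h)
... | inj₂ h = inj₂ (∣ᵤ⇒∣ h)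

record SimpleRoots (f : ℤ[x].Poly) (p : ℕ) : Set where
  field
    isPrime  : Prime p
    root     : ℤ
    isRoot   : + p ∣ ev f root
    isSimple : ∀ a → + p ∣ ev f a → ¬ + p ∣ ev′ f a

R⇒simpleRoots : ∀ {f q} → Nonconstant f → R f q → SimpleRoots f q
R⇒simpleRoots {f} {q} (n , 0<n , fₙ≢0 , _) (good , r , fr≡0) = record
  { isPrime  = isPrime
  ; root     = r
  ; isRoot   = ≡0⇒∣ (𝔽.trans (𝔽.sym (eval-reduce f r)) fr≡0)
  ; isSimple = isSimple degree hasDegree sameDegree isDiscriminant
  }
  where
  open Good good
  module 𝔽 = CommutativeRing (ℤ/ q)
  module P = PolynomialProperties (ℤ/ q)

  isSimple : ∀ m → ℤ[x].HasDegree f m → 𝔽[x].HasDegree q f m →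
    𝔽[x].IsDiscriminant q m f disc → ∀ a → + q ∣ ev f a → ¬ + q ∣ ev′ f a
  isSimple zero    (_ , f≡0) _ _ a _ _ = fₙ≢0 (f≡0 n 0<n)
  isSimple (suc m) _ (fₘ≢0 , f≈0) isDisc a q∣fa q∣f′a =
    [ (λ h → fₘ≢0 (∣⇒≡0 h)) , (λ h → disc≢0 (∣⇒≡0 h)) ]′
      (prime∣*⇒∣⊎∣ isPrime (𝔽[x].coeff q f (suc m)) disc (≡0⇒∣ (P.multipleRoot⇒disc≈0 m f disc a f≈0 isDisc
        (𝔽.trans (eval-reduce f a) (∣⇒≡0 q∣fa))
        (𝔽.trans (eval-derivative-reduce f a) (∣⇒≡0 q∣f′a)))))

taylor : ∀ f a h → ∃[ k ] ev f (a ℤ.+ h) ≡ ev f a ℤ.+ h ℤ.* ev′ f a ℤ.+ h ℤ.* h ℤ.* k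
taylor []      a h = 0ℤ , lemma h
  where
  lemma : ∀ h → 0ℤ ≡ 0ℤ ℤ.+ h ℤ.* 0ℤ ℤ.+ h ℤ.* h ℤ.* 0ℤ
  lemma = solve-∀
taylor (b ∷ f) a h with taylor f a h
... | k , eq = ev′ f a ℤ.+ (a ℤ.+ h) ℤ.* k , (begin
  b ℤ.+ (a ℤ.+ h) ℤ.* ev f (a ℤ.+ h)
    ≡⟨ cong (λ e → b ℤ.+ (a ℤ.+ h) ℤ.* e) eq ⟩
  b ℤ.+ (a ℤ.+ h) ℤ.* (ev f a ℤ.+ h ℤ.* ev′ f a ℤ.+ h ℤ.* h ℤ.* k)
    ≡⟨ lemma b a h (ev f a) (ev′ f a) k ⟩
  b ℤ.+ a ℤ.* ev f a ℤ.+ h ℤ.* (ev f a ℤ.+ a ℤ.* ev′ f a) ℤ.+ h ℤ.* h ℤ.* (ev′ f a ℤ.+ (a ℤ.+ h) ℤ.* k)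
    ≡⟨ cong (λ e → b ℤ.+ a ℤ.* ev f a ℤ.+ h ℤ.* e ℤ.+ h ℤ.* h ℤ.* (ev′ f a ℤ.+ (a ℤ.+ h) ℤ.* k)) (ev′-∷ b f a) ⟨
  b ℤ.+ a ℤ.* ev f a ℤ.+ h ℤ.* ev′ (b ∷ f) a ℤ.+ h ℤ.* h ℤ.* (ev′ f a ℤ.+ (a ℤ.+ h) ℤ.* k) ∎)
  where
  open ≡-Reasoning
  lemma : ∀ b a h e d k → b ℤ.+ (a ℤ.+ h) ℤ.* (e ℤ.+ h ℤ.* d ℤ.+ h ℤ.* h ℤ.* k) ≡
    b ℤ.+ a ℤ.* e ℤ.+ h ℤ.* (e ℤ.+ a ℤ.* d) ℤ.+ h ℤ.* h ℤ.* (d ℤ.+ (a ℤ.+ h) ℤ.* k)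
  lemma = solve-∀

ev-mod : ∀ {m} f a h → m ∣ h → ∃[ e ] ev f (a ℤ.+ h) ≡ ev f a ℤ.+ e × m ∣ e
ev-mod f a h m∣h with taylor f a h
... | k , eq = _ , trans eq (ℤ.+-assoc (ev f a) _ _) ,
  ∣m∣n⇒∣m+n (∣m⇒∣m*n (ev′ f a) m∣h) (∣m⇒∣m*n k (∣m⇒∣m*n h m∣h))

clear-denominators : ∀ u → ∃[ c ] c ≢ 0ℤ ×
  ∀ a → ∃[ m ] fromℤ c ℚ.* ℚ[x].eval u (fromℤ a) ≡ fromℤ m
clear-denominators []      = 1ℤ , (λ ()) , λ a → 0ℤ , refl
clear-denominators (r ∷ u) with clear-denominators u
... | c , c≢0 , integral = ℚ.denominator r ℤ.* c ,
  (λ eq → [ (λ ()) , c≢0 ]′ (ℤ.i*j≡0⇒i≡0∨j≡0 (ℚ.denominator r) eq)) , λ a →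
  let (m , eq) = integral a in
  c ℤ.* ℚ.numerator r ℤ.+ ℚ.denominator r ℤ.* a ℤ.* m , (begin
    fromℤ (ℚ.denominator r ℤ.* c) ℚ.* (r ℚ.+ fromℤ a ℚ.* ℚ[x].eval u (fromℤ a))
      ≡⟨ cong (ℚ._* (r ℚ.+ fromℤ a ℚ.* ℚ[x].eval u (fromℤ a))) (fromℤ-* (ℚ.denominator r) c) ⟩
    D ℚ.* fromℤ c ℚ.* (r ℚ.+ fromℤ a ℚ.* ℚ[x].eval u (fromℤ a))
      ≡⟨ ℚ-Solver.solve 5 (λ d c r a e → d :* c :* (r :+ a :* e) := c :* (d :* r) :+ d :* a :* (c :* e))
           refl D (fromℤ c) r (fromℤ a) (ℚ[x].eval u (fromℤ a)) ⟩
    fromℤ c ℚ.* (D ℚ.* r) ℚ.+ D ℚ.* fromℤ a ℚ.* (fromℤ c ℚ.* ℚ[x].eval u (fromℤ a))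
      ≡⟨ cong₂ (λ x y → fromℤ c ℚ.* x ℚ.+ D ℚ.* fromℤ a ℚ.* y) (denominator*r r) eq ⟩
    fromℤ c ℚ.* fromℤ (ℚ.numerator r) ℚ.+ D ℚ.* fromℤ a ℚ.* fromℤ m
      ≡⟨ cong₂ ℚ._+_ (fromℤ-* c (ℚ.numerator r))
           (trans (fromℤ-* (ℚ.denominator r ℤ.* a) m) (cong (ℚ._* fromℤ m) (fromℤ-* (ℚ.denominator r) a))) ⟨
    fromℤ (c ℤ.* ℚ.numerator r) ℚ.+ fromℤ (ℚ.denominator r ℤ.* a ℤ.* m)
      ≡⟨ fromℤ-+ (c ℤ.* ℚ.numerator r) (ℚ.denominator r ℤ.* a ℤ.* m) ⟨
    fromℤ (c ℤ.* ℚ.numerator r ℤ.+ ℚ.denominator r ℤ.* a ℤ.* m) ∎)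
  where
  open ≡-Reasoning
  module ℚ-Solver = PolynomialProperties.ℕ-Solver ℚ.+-*-commutativeRing
  open ℚ-Solver using (_:+_; _:*_; _:=_)
  D = fromℤ (ℚ.denominator r)

  denominator*r : ∀ r → fromℤ (ℚ.denominator r) ℚ.* r ≡ fromℤ (ℚ.numerator r)
  denominator*r r@record{} = ℚ.toℚᵘ-injective (ℚᵘ.≃-trans
    (ℚ.toℚᵘ-homo-* (fromℤ (ℚ.denominator r)) r)
    (ℚᵘ.*≡* (lemma (ℚ.denominator r) (ℚ.numerator r))))
    where
    lemma : ∀ d n → d ℤ.* n ℤ.* 1ℤ ≡ n ℤ.* (1ℤ ℤ.* d)
    lemma = solve-∀

separable⇒bézout : ∀ f → Separable f → ∃[ c ] c ≢ 0ℤ ×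
  ∀ a → ∃[ u ] ∃[ v ] u ℤ.* ev f a ℤ.+ v ℤ.* ev′ f a ≡ c
separable⇒bézout f (u , v , uf+vf′≈1) with clear-denominators u | clear-denominators v
... | c , c≢0 , u-integral | d , d≢0 , v-integral =
  c ℤ.* d , ([ c≢0 , d≢0 ]′ ∘ ℤ.i*j≡0⇒i≡0∨j≡0 c) , λ a →
  let (m , cu≡m) = u-integral a
      (n , dv≡n) = v-integral a
      U = ℚ[x].eval u (fromℤ a)
      V = ℚ[x].eval v (fromℤ a)
  in d ℤ.* m , c ℤ.* n , fromℤ-injective (begin
    fromℤ (d ℤ.* m ℤ.* ev f a ℤ.+ c ℤ.* n ℤ.* ev′ f a)
      ≡⟨ fromℤ-+ (d ℤ.* m ℤ.* ev f a) (c ℤ.* n ℤ.* ev′ f a) ⟩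
    fromℤ (d ℤ.* m ℤ.* ev f a) ℚ.+ fromℤ (c ℤ.* n ℤ.* ev′ f a)
      ≡⟨ cong₂ ℚ._+_ (fromℤ-*₃ d m (ev f a)) (fromℤ-*₃ c n (ev′ f a)) ⟩
    fromℤ d ℚ.* fromℤ m ℚ.* fromℤ (ev f a) ℚ.+ fromℤ c ℚ.* fromℤ n ℚ.* fromℤ (ev′ f a)
      ≡⟨ cong₂ (λ x y → fromℤ d ℚ.* x ℚ.* fromℤ (ev f a) ℚ.+ fromℤ c ℚ.* y ℚ.* fromℤ (ev′ f a)) cu≡m dv≡n ⟨
    fromℤ d ℚ.* (fromℤ c ℚ.* U) ℚ.* fromℤ (ev f a) ℚ.+ fromℤ c ℚ.* (fromℤ d ℚ.* V) ℚ.* fromℤ (ev′ f a)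
      ≡⟨ ℚ-Solver.solve 6 (λ c d U V F G → d :* (c :* U) :* F :+ c :* (d :* V) :* G := c :* d :* (U :* F :+ V :* G))
           refl (fromℤ c) (fromℤ d) U V (fromℤ (ev f a)) (fromℤ (ev′ f a)) ⟩
    fromℤ c ℚ.* fromℤ d ℚ.* (U ℚ.* fromℤ (ev f a) ℚ.+ V ℚ.* fromℤ (ev′ f a))
      ≡⟨ cong₂ ℚ._*_ (fromℤ-* c d) (sym (identity a)) ⟨
    fromℤ (c ℤ.* d) ℚ.* ℚ.1ℚ
      ≡⟨ ℚ.*-identityʳ _ ⟩
    fromℤ (c ℤ.* d) ∎)
  where
  open ≡-Reasoning
  module P = PolynomialProperties ℚ.+-*-commutativeRing
  module ℚ-Solver = P.ℕ-Solver
  open ℚ-Solver using (_:+_; _:*_; _:=_)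

  fromℤ-*₃ : ∀ i j k → fromℤ (i ℤ.* j ℤ.* k) ≡ fromℤ i ℚ.* fromℤ j ℚ.* fromℤ k
  fromℤ-*₃ i j k = trans (fromℤ-* (i ℤ.* j) k) (cong (ℚ._* fromℤ k) (fromℤ-* i j))

  g = toℚ[x] f
  g′ = ℚ[x].derivative g

  identity : ∀ a → ℚ[x].eval u (fromℤ a) ℚ.* fromℤ (ev f a) ℚ.+ ℚ[x].eval v (fromℤ a) ℚ.* fromℤ (ev′ f a) ≡ ℚ.1ℚ
  identity a = begin
    ℚ[x].eval u x ℚ.* fromℤ (ev f a) ℚ.+ ℚ[x].eval v x ℚ.* fromℤ (ev′ f a)
      ≡⟨ cong₂ (λ y z → ℚ[x].eval u x ℚ.* y ℚ.+ ℚ[x].eval v x ℚ.* z)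
           (eval-map ℤ.+-*-commutativeRing ℚ.+-*-commutativeRing fromℤ-isHom f a)
           (eval-derivative-map ℤ.+-*-commutativeRing ℚ.+-*-commutativeRing fromℤ-isHom f a) ⟨
    ℚ[x].eval u x ℚ.* ℚ[x].eval g x ℚ.+ ℚ[x].eval v x ℚ.* ℚ[x].eval g′ x
      ≡⟨ cong₂ ℚ._+_ (P.eval-*ₚ u g x) (P.eval-*ₚ v g′ x) ⟨
    ℚ[x].eval (u ℚ[x].*ₚ g) x ℚ.+ ℚ[x].eval (v ℚ[x].*ₚ g′) x
      ≡⟨ P.eval-+ₚ (u ℚ[x].*ₚ g) (v ℚ[x].*ₚ g′) x ⟨
    ℚ[x].eval (u ℚ[x].*ₚ g ℚ[x].+ₚ v ℚ[x].*ₚ g′) x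
      ≡⟨ P.eval-cong (u ℚ[x].*ₚ g ℚ[x].+ₚ v ℚ[x].*ₚ g′) ℚ[x].1ₚ x uf+vf′≈1 ⟩
    ℚ.1ℚ ℚ.+ x ℚ.* 0ℚ
      ≡⟨ trans (cong (ℚ.1ℚ ℚ.+_) (ℚ.*-zeroʳ x)) (ℚ.+-identityʳ ℚ.1ℚ) ⟩
    ℚ.1ℚ ∎
    where x = fromℤ a

∣w∣≤∣u*w∣ : ∀ u w → u ≢ 0ℤ → ℤ.∣ w ∣ ≤ ℤ.∣ u ℤ.* w ∣
∣w∣≤∣u*w∣ u w u≢0 = subst (ℤ.∣ w ∣ ≤_) (sym (ℤ.abs-* u w))
  (ℕ.m≤n*m ℤ.∣ w ∣ ℤ.∣ u ∣ {{ℤ.≢-nonZero u≢0}})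

eventually≢0 : ∀ f n → ℤ[x].HasDegree f n → ∃[ X ] ∀ x → X ≤ x → ev f (+ x) ≢ 0ℤ
eventually≢0 []      n       (fₙ≢0 , _)   = contradiction refl fₙ≢0
eventually≢0 (a ∷ f) zero    (a≢0 , f≡0) = 0 , λ x _ eq → a≢0 (trans (sym (begin
  a ℤ.+ + x ℤ.* ev f (+ x) ≡⟨ cong (λ e → a ℤ.+ + x ℤ.* e) (eval-vanishing f (+ x) λ i _ → f≡0 (suc i) (s≤s z≤n)) ⟩
  a ℤ.+ + x ℤ.* 0ℤ         ≡⟨ cong (λ e → a ℤ.+ e) (ℤ.*-zeroʳ (+ x)) ⟩
  a ℤ.+ 0ℤ                 ≡⟨ ℤ.+-identityʳ a ⟩
  a                        ∎)) eq)
  where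
  open ≡-Reasoning
  open PolynomialProperties ℤ.+-*-commutativeRing using (eval-vanishing)
eventually≢0 (a ∷ f) (suc n) (fₙ≢0 , f≡0)
  with eventually≢0 f n (fₙ≢0 , λ i n<i → f≡0 (suc i) (s≤s n<i))
... | X , f≢0 = suc ℤ.∣ a ∣ ℕ.+ X , λ x bound eq → ℕ.<-irrefl refl (begin-strict
  ℤ.∣ a ∣                        <⟨ ℕ.m≤m+n (suc ℤ.∣ a ∣) X ⟩
  suc ℤ.∣ a ∣ ℕ.+ X              ≤⟨ bound ⟩
  x                              ≤⟨ ∣w∣≤∣u*w∣ (ev f (+ x)) (+ x) (f≢0 x (ℕ.≤-trans (ℕ.m≤n+m X (suc ℤ.∣ a ∣)) bound)) ⟩
  ℤ.∣ ev f (+ x) ℤ.* + x ∣       ≡⟨ cong ℤ.∣_∣ (lemma a (+ x) (ev f (+ x))) ⟩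
  ℤ.∣ ev (a ∷ f) (+ x) ℤ.- a ∣   ≡⟨ cong (λ e → ℤ.∣ e ℤ.- a ∣) eq ⟩
  ℤ.∣ 0ℤ ℤ.- a ∣                 ≡⟨ cong ℤ.∣_∣ (ℤ.+-identityˡ (ℤ.- a)) ⟩
  ℤ.∣ ℤ.- a ∣                    ≡⟨ ℤ.∣-i∣≡∣i∣ a ⟩
  ℤ.∣ a ∣                        ∎)
  where
  open ℕ.≤-Reasoning
  lemma : ∀ a x e → e ℤ.* x ≡ a ℤ.+ x ℤ.* e ℤ.- a
  lemma = solve-∀

∃-primeDivisor : ∀ n → n ≢ 1 → ∃[ p ] Prime p × p ℕ.∣ n
∃-primeDivisor zero      _   = 2 , prime[2] , 2 ℕ.∣0
∃-primeDivisor n@(suc _) n≢1 with factorise n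
... | record { factors = [] ; isFactorisation = n≡1 } = contradiction n≡1 n≢1
... | record { factors = p ∷ ps ; isFactorisation = n≡ ; factorsPrime = pr ∷ _ } =
  p , pr , subst (p ℕ.∣_) (sym n≡) (ℕ.m∣m*n (ℕ.product ps))

prime∤1 : ∀ {p} → Prime p → ¬ + p ∣ 1ℤ
prime∤1 pr p∣1 = ¬prime[1] (subst Prime (ℕ.∣1⇒≡1 (∣⇒∣ᵤ p∣1)) pr)

∃-largePrimeDivisor : ∀ B w → 3 ≤ ℤ.∣ w ∣ →
  ∃[ p ] Prime p × B < p × + p ∣ 1ℤ ℤ.+ + (B !) ℤ.* w
∃-largePrimeDivisor B w 3≤∣w∣ with ∃-primeDivisor ℤ.∣ 1ℤ ℤ.+ + (B !) ℤ.* w ∣ nonUnit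
  where
  open ℕ.≤-Reasoning
  nonUnit : ℤ.∣ 1ℤ ℤ.+ + (B !) ℤ.* w ∣ ≢ 1
  nonUnit eq = ℕ.<-irrefl refl (begin-strict
    2                                             <⟨ 3≤∣w∣ ⟩
    ℤ.∣ w ∣                                       ≤⟨ ∣w∣≤∣u*w∣ (+ (B !)) w (λ eq → contradiction (ℤ.+-injective eq) (ℕ.m<n⇒n≢0 (ℕ.1≤n! B))) ⟩
    ℤ.∣ + (B !) ℤ.* w ∣                           ≡⟨ cong ℤ.∣_∣ (lemma (+ (B !) ℤ.* w)) ⟩
    ℤ.∣ 1ℤ ℤ.+ + (B !) ℤ.* w ℤ.- 1ℤ ∣             ≤⟨ ℤ.∣i-j∣≤∣i∣+∣j∣ (1ℤ ℤ.+ + (B !) ℤ.* w) 1ℤ ⟩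
    ℤ.∣ 1ℤ ℤ.+ + (B !) ℤ.* w ∣ ℕ.+ 1              ≡⟨ cong (ℕ._+ 1) eq ⟩
    2                                             ∎)
    where
    lemma : ∀ x → x ≡ 1ℤ ℤ.+ x ℤ.- 1ℤ
    lemma = solve-∀
... | p , pr , p∣ = p , pr , ℕ.≰⇒> (λ p≤B → prime∤1 pr (∣m+n∣n⇒∣m {m = 1ℤ} {+ (B !) ℤ.* w} (∣ᵤ⇒∣ p∣)
  (∣m⇒∣m*n {m = + (B !)} w (∣ᵤ⇒∣ (ℕ.∣-trans (p∣p! p pr) (ℕ.m≤n⇒m!∣n! p≤B)))))) , ∣ᵤ⇒∣ p∣
  where
  p∣p! : ∀ p → Prime p → p ℕ.∣ p !
  p∣p! zero    pr = contradiction pr ¬prime[0]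
  p∣p! (suc p) pr = ℕ.m∣m*n (p !)

∃-largePrimeDivisor′ : ∀ B b t e → b ≢ 0ℤ → 3 ≤ t → e ≢ 0ℤ →
  ∃[ p ] Prime p × B < p × + p ∣ b ℤ.+ + (ℤ.∣ b ∣ ℕ.* (B ! ℕ.* t)) ℤ.* e
∃-largePrimeDivisor′ B b t e b≢0 3≤t e≢0 with m∣∣m∣ {b}
... | divides s ∣b∣≡s*b =
  let (p , pr , B<p , p∣) = ∃-largePrimeDivisor B (s ℤ.* (e ℤ.* + t)) 3≤∣w∣
  in p , pr , B<p , subst (+ p ∣_) (sym factorisation) (∣n⇒∣m*n b p∣)
  where
  s≢0 : s ≢ 0ℤ
  s≢0 s≡0 = b≢0 (ℤ.∣i∣≡0⇒i≡0 (ℤ.+-injective (trans ∣b∣≡s*b (cong (ℤ._* b) s≡0))))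

  3≤∣w∣ : 3 ≤ ℤ.∣ s ℤ.* (e ℤ.* + t) ∣
  3≤∣w∣ = ℕ.≤-trans 3≤t (ℕ.≤-trans (∣w∣≤∣u*w∣ e (+ t) e≢0) (∣w∣≤∣u*w∣ s (e ℤ.* + t) s≢0))

  lemma : ∀ b s F t e → b ℤ.+ s ℤ.* b ℤ.* (F ℤ.* t) ℤ.* e ≡ b ℤ.* (1ℤ ℤ.+ F ℤ.* (s ℤ.* (e ℤ.* t)))
  lemma = solve-∀

  factorisation : b ℤ.+ + (ℤ.∣ b ∣ ℕ.* (B ! ℕ.* t)) ℤ.* e ≡ b ℤ.* (1ℤ ℤ.+ + (B !) ℤ.* (s ℤ.* (e ℤ.* + t)))
  factorisation = trans
    (cong (λ y → b ℤ.+ y ℤ.* e) (trans (ℤ.pos-* ℤ.∣ b ∣ (B ! ℕ.* t)) (cong₂ ℤ._*_ ∣b∣≡s*b (ℤ.pos-* (B !) t))))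
    (lemma b s (+ (B !)) (+ t) e)

schur : ∀ f → Nonconstant f → ∀ B → ∃[ p ] ∃[ a ] Prime p × B < p × + p ∣ ev f a
schur []      (n , _ , fₙ≢0 , _) B = contradiction refl fₙ≢0
schur (b ∷ f) (suc n , _ , fₙ≢0 , f≡0) B with b ℤ.≟ 0ℤ
... | yes refl =
  let (p , pr , B<p , _) = ∃-largePrimeDivisor B (+ 3) ℕ.≤-refl
  in p , 0ℤ , pr , B<p , divides 0ℤ refl
... | no b≢0 =
  let (X , f≢0) = eventually≢0 f n (fₙ≢0 , λ i n<i → f≡0 (suc i) (s≤s n<i))
      t = 3 ℕ.+ X
      x = ℤ.∣ b ∣ ℕ.* (B ! ℕ.* t)
      X≤x = ℕ.≤-trans (ℕ.m≤n+m X 3) (ℕ.≤-trans (ℕ.m≤n*m t (B !) {{B ℕ.!≢0}})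
              (ℕ.m≤n*m (B ! ℕ.* t) ℤ.∣ b ∣ {{ℤ.≢-nonZero b≢0}}))
      (p , pr , B<p , p∣) = ∃-largePrimeDivisor′ B b t (ev f (+ x)) b≢0 (ℕ.m≤m+n 3 X) (f≢0 x X≤x)
  in p , + x , pr , B<p , p∣

bézout⇒simpleRoots : ∀ {f c p r} → c ≢ 0ℤ →
  (∀ a → ∃[ u ] ∃[ v ] u ℤ.* ev f a ℤ.+ v ℤ.* ev′ f a ≡ c) →
  Prime p → ℤ.∣ c ∣ < p → + p ∣ ev f r → SimpleRoots f p
bézout⇒simpleRoots {f} {c} {p} {r} c≢0 bézout pr ∣c∣<p p∣fr = record
  { isPrime  = pr
  ; root     = r
  ; isRoot   = p∣fr
  ; isSimple = λ a p∣fa p∣f′a →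
      let (u , v , eq) = bézout a in
      ℕ.>⇒∤ {{ℤ.≢-nonZero c≢0}} ∣c∣<p
        (∣⇒∣ᵤ (subst (+ p ∣_) eq (∣m∣n⇒∣m+n (∣n⇒∣m*n u p∣fa) (∣n⇒∣m*n v p∣f′a))))
  }

simpleRoots-large : ∀ f → Nonconstant f → Separable f → ∀ B → ∃[ p ] B < p × SimpleRoots f p
simpleRoots-large f nonconstant separable B =
  let (c , c≢0 , bézout) = separable⇒bézout f separable
      (p , r , pr , B+∣c∣<p , p∣fr) = schur f nonconstant (B ℕ.+ ℤ.∣ c ∣)
  in p , ℕ.≤-<-trans (ℕ.m≤m+n B ℤ.∣ c ∣) B+∣c∣<p ,
     bézout⇒simpleRoots c≢0 bézout pr (ℕ.≤-<-trans (ℕ.m≤n+m ℤ.∣ c ∣ B) B+∣c∣<p) p∣fr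

ExactlyDivides : ℤ[x].Poly → ℤ → ℕ → Set
ExactlyDivides f a q = + q ∣ ev f a × ¬ + q ℤ.* + q ∣ ev f a

exactlyDivides-shift : ∀ f a h {q} → + q ℤ.* + q ∣ h → ExactlyDivides f a q → ExactlyDivides f (a ℤ.+ h) q
exactlyDivides-shift f a h {q} q²∣h (q∣fa , q²∤fa) =
  let (e , eq , q²∣e) = ev-mod f a h q²∣h
  in subst (+ q ∣_) (sym eq) (∣m∣n⇒∣m+n q∣fa (∣-trans (∣m⇒∣m*n (+ q) ∣-refl) q²∣e)) ,
     λ q²∣ → q²∤fa (∣m+n∣n⇒∣m {m = ev f a} (subst (+ q ℤ.* + q ∣_) eq q²∣) q²∣e)

prime∤⇒coprime : ∀ {p} n → Prime p → ¬ p ℕ.∣ n → Coprime p n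
prime∤⇒coprime n pr p∤n (d∣p , d∣n) with prime⇒irreducible pr d∣p
... | inj₁ d≡1  = d≡1
... | inj₂ refl = contradiction d∣n p∤n

inverseMod : ∀ {p} n → Prime p → ¬ p ℕ.∣ n → ∃[ u ] + p ∣ + n ℤ.* u ℤ.- 1ℤ
inverseMod {p} n pr p∤n with coprime-Bézout (prime∤⇒coprime n pr p∤n)
... | Bézout.+- x y eq = ℤ.- + y , divides (ℤ.- + x) (begin
  + n ℤ.* (ℤ.- + y) ℤ.- 1ℤ       ≡⟨ lemma (+ n) (+ y) ⟩
  ℤ.- (1ℤ ℤ.+ + y ℤ.* + n)       ≡⟨ cong (λ z → ℤ.- (1ℤ ℤ.+ z)) (ℤ.pos-* y n) ⟨
  ℤ.- + (1 ℕ.+ y ℕ.* n)          ≡⟨ cong (λ z → ℤ.- + z) eq ⟩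
  ℤ.- + (x ℕ.* p)                ≡⟨ cong ℤ.-_ (ℤ.pos-* x p) ⟩
  ℤ.- (+ x ℤ.* + p)              ≡⟨ ℤ.neg-distribˡ-* (+ x) (+ p) ⟩
  ℤ.- + x ℤ.* + p                ∎)
  where
  open ≡-Reasoning
  lemma : ∀ n y → n ℤ.* (ℤ.- y) ℤ.- 1ℤ ≡ ℤ.- (1ℤ ℤ.+ y ℤ.* n)
  lemma = solve-∀
... | Bézout.-+ x y eq = + y , divides (+ x) (begin
  + n ℤ.* + y ℤ.- 1ℤ             ≡⟨ cong (ℤ._- 1ℤ) (trans (ℤ.*-comm (+ n) (+ y)) (sym (ℤ.pos-* y n))) ⟩
  + (y ℕ.* n) ℤ.- 1ℤ             ≡⟨ cong (λ z → + z ℤ.- 1ℤ) eq ⟨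
  1ℤ ℤ.+ + (x ℕ.* p) ℤ.- 1ℤ      ≡⟨ lemma (+ (x ℕ.* p)) ⟩
  + (x ℕ.* p)                    ≡⟨ ℤ.pos-* x p ⟩
  + x ℤ.* + p                    ∎)
  where
  open ≡-Reasoning
  lemma : ∀ z → 1ℤ ℤ.+ z ℤ.- 1ℤ ≡ z
  lemma = solve-∀

root-inProgression : ∀ {f q} → SimpleRoots f q → ∀ P a → ¬ q ℕ.∣ P → ∃[ t ] + q ∣ ev f (a ℤ.+ + P ℤ.* t)
root-inProgression {f} {q} simple P a q∤P =
  let (u , q∣Pu-1) = inverseMod P isPrime q∤P
      (e , eq , q∣e) = ev-mod f root ((+ P ℤ.* u ℤ.- 1ℤ) ℤ.* (root ℤ.- a)) (∣m⇒∣m*n (root ℤ.- a) q∣Pu-1)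
  in u ℤ.* (root ℤ.- a) ,
     subst (λ b → + q ∣ ev f b) (lemma root (+ P) u a) (subst (+ q ∣_) (sym eq) (∣m∣n⇒∣m+n isRoot q∣e))
  where
  open SimpleRoots simple
  lemma : ∀ r P u a → r ℤ.+ (P ℤ.* u ℤ.- 1ℤ) ℤ.* (r ℤ.- a) ≡ a ℤ.+ P ℤ.* (u ℤ.* (r ℤ.- a))
  lemma = solve-∀

exact-unless-shift-exact : ∀ {f q} → SimpleRoots f q → ∀ P b → ¬ q ℕ.∣ P → + q ∣ ev f b →
  ExactlyDivides f b q ⊎ ExactlyDivides f (b ℤ.+ + P ℤ.* + q) q
exact-unless-shift-exact {f} {q} simple P b q∤P q∣fb with (+ q ℤ.* + q) ∣? ev f b
... | no  q²∤fb = inj₁ (q∣fb , q²∤fb)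
... | yes q²∣fb = inj₂ (q∣shift , q²∤shift)
  where
  open SimpleRoots simple
  h = + P ℤ.* + q
  k = proj₁ (taylor f b h)
  expansion : ev f (b ℤ.+ h) ≡ ev f b ℤ.+ h ℤ.* ev′ f b ℤ.+ h ℤ.* h ℤ.* k
  expansion = proj₂ (taylor f b h)

  lemma₁ : ∀ P q d → P ℤ.* q ℤ.* d ≡ q ℤ.* (P ℤ.* d)
  lemma₁ = solve-∀
  lemma₂ : ∀ P q k → P ℤ.* q ℤ.* (P ℤ.* q) ℤ.* k ≡ P ℤ.* P ℤ.* k ℤ.* (q ℤ.* q)
  lemma₂ = solve-∀

  q∣h : + q ∣ h
  q∣h = ∣n⇒∣m*n (+ P) ∣-refl

  q²∣h²k : + q ℤ.* + q ∣ h ℤ.* h ℤ.* k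
  q²∣h²k = divides (+ P ℤ.* + P ℤ.* k) (lemma₂ (+ P) (+ q) k)

  q∣shift : + q ∣ ev f (b ℤ.+ h)
  q∣shift = subst (+ q ∣_) (sym expansion)
    (∣m∣n⇒∣m+n (∣m∣n⇒∣m+n q∣fb (∣m⇒∣m*n (ev′ f b) q∣h)) (∣m⇒∣m*n k (∣m⇒∣m*n h q∣h)))

  q²∤shift : ¬ + q ℤ.* + q ∣ ev f (b ℤ.+ h)
  q²∤shift q²∣ = [ (λ q∣P → q∤P (∣⇒∣ᵤ q∣P)) , isSimple b q∣fb ]′ (prime∣*⇒∣⊎∣ isPrime (+ P) (ev′ f b) q∣Pf′b)
    where
    q²∣hf′b : + q ℤ.* + q ∣ h ℤ.* ev′ f b
    q²∣hf′b = ∣m+n∣m⇒∣n {m = ev f b} (∣m+n∣n⇒∣m {m = ev f b ℤ.+ h ℤ.* ev′ f b} {h ℤ.* h ℤ.* k}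
      (subst (+ q ℤ.* + q ∣_) expansion q²∣) q²∣h²k) q²∣fb
    q∣Pf′b : + q ∣ + P ℤ.* ev′ f b
    q∣Pf′b = *-cancelˡ-∣ (+ q) {{prime⇒nonZero isPrime}}
      (subst (+ q ℤ.* + q ∣_) (lemma₁ (+ P) (+ q) (ev′ f b)) q²∣hf′b)

exactRoot-inProgression : ∀ {f q} → SimpleRoots f q → ∀ P a → ¬ q ℕ.∣ P →
  ∃[ t ] ExactlyDivides f (a ℤ.+ + P ℤ.* t) q
exactRoot-inProgression {f} {q} simple P a q∤P =
  let (t , q∣fb) = root-inProgression simple P a q∤P
  in [ (λ exact → t , exact)
     , (λ exact → t ℤ.+ + q , subst (λ b → ExactlyDivides f b q) (lemma a (+ P) t (+ q)) exact) ]′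
     (exact-unless-shift-exact simple P (a ℤ.+ + P ℤ.* t) q∤P q∣fb)
  where
  lemma : ∀ a P t q → a ℤ.+ P ℤ.* t ℤ.+ P ℤ.* q ≡ a ℤ.+ P ℤ.* (t ℤ.+ q)
  lemma = solve-∀

record SimultaneousRoot (f : ℤ[x].Poly) (L : List ℕ) : Set where
  field
    value      : ℤ
    modulus    : ℕ
    exact      : All (ExactlyDivides f value) L
    squares    : All (λ q → + q ℤ.* + q ∣ + modulus) L
    primes     : ∀ {q} → Prime q → q ℕ.∣ modulus → q ∈ L

simultaneousRoot : ∀ {f L} → All (SimpleRoots f) L → SimultaneousRoot f L
simultaneousRoot [] = record
  { value   = 0ℤ
  ; modulus = 1
  ; exact   = []
  ; squares = []
  ; primes  = λ pr q∣1 → contradiction (∣ᵤ⇒∣ q∣1) (prime∤1 pr)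
  }
simultaneousRoot {f} {q ∷ L} (simple ∷ simples) with q ∈? L
... | yes q∈L = record
  { value   = value
  ; modulus = modulus
  ; exact   = All.lookup exact q∈L ∷ exact
  ; squares = All.lookup squares q∈L ∷ squares
  ; primes  = λ pr q∣P → there (primes pr q∣P)
  }
  where open SimultaneousRoot (simultaneousRoot simples)
... | no q∉L = record
  { value   = value ℤ.+ + modulus ℤ.* proj₁ new
  ; modulus = modulus ℕ.* (q ℕ.* q)
  ; exact   = proj₂ new ∷ All.zipWith (λ {r} (r²∣P , r-exact) →
      exactlyDivides-shift f value _ {r} (∣m⇒∣m*n (proj₁ new) r²∣P) r-exact) (squares , exact)
  ; squares = subst (+ q ℤ.* + q ∣_) (sym P′≡) (∣n⇒∣m*n (+ modulus) ∣-refl) ∷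
      All.map (λ {r} r²∣P → subst (+ r ℤ.* + r ∣_) (sym P′≡) (∣m⇒∣m*n (+ q ℤ.* + q) r²∣P)) squares
  ; primes  = λ pr r∣P′ → [ (λ r∣P → there (primes pr r∣P)) ,
      (λ r∣q² → here ([ prime∣prime pr , prime∣prime pr ]′ (euclidsLemma q q pr r∣q²))) ]′
      (euclidsLemma modulus (q ℕ.* q) pr r∣P′)
  }
  where
  open SimultaneousRoot (simultaneousRoot simples)
  open SimpleRoots simple using (isPrime)
  new = exactRoot-inProgression simple modulus value (λ q∣P → q∉L (primes isPrime q∣P))

  P′≡ : + (modulus ℕ.* (q ℕ.* q)) ≡ + modulus ℤ.* (+ q ℤ.* + q)
  P′≡ = trans (ℤ.pos-* modulus (q ℕ.* q)) (cong (+ modulus ℤ.*_) (ℤ.pos-* q q))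

  prime∣prime : ∀ {r} → Prime r → r ℕ.∣ q → r ≡ q
  prime∣prime pr r∣q with prime⇒irreducible isPrime r∣q
  ... | inj₁ refl = contradiction pr ¬prime[1]
  ... | inj₂ r≡q  = r≡q

squarefree-decomposition : ∀ z → z ≢ 0ℤ → ∃[ d ] ∃[ s ] z ≡ d ℤ.* (s ℤ.* s) × Squarefree d
squarefree-decomposition z z≢0 = go z z≢0 (<-wellFounded ℤ.∣ z ∣)
  where
  lemma : ∀ d s k → d ℤ.* (s ℤ.* s) ℤ.* (k ℤ.* k) ≡ d ℤ.* (s ℤ.* k ℤ.* (s ℤ.* k))
  lemma = solve-∀
  lemma₁ : ∀ z → z ≡ z ℤ.* (1ℤ ℤ.* 1ℤ)
  lemma₁ = solve-∀

  go : ∀ z → z ≢ 0ℤ → Acc _<_ ℤ.∣ z ∣ → ∃[ d ] ∃[ s ] z ≡ d ℤ.* (s ℤ.* s) × Squarefree d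
  go z z≢0 (acc rec) with ℕ.anyUpTo? (λ k → (1 ℕ.<? k) ×-dec ((+ k ℤ.* + k) ∣? z)) (suc ℤ.∣ z ∣)
  ... | yes (k , _ , 1<k , divides y z≡yk²) with go y y≢0 (rec ∣y∣<∣z∣)
    where
    y≢0 : y ≢ 0ℤ
    y≢0 y≡0 = z≢0 (trans z≡yk² (cong (ℤ._* (+ k ℤ.* + k)) y≡0))
    ∣y∣<∣z∣ : ℤ.∣ y ∣ < ℤ.∣ z ∣
    ∣y∣<∣z∣ = subst (ℤ.∣ y ∣ <_) (sym (trans (cong ℤ.∣_∣ z≡yk²) (trans (ℤ.abs-* y (+ k ℤ.* + k))
      (cong (ℤ.∣ y ∣ ℕ.*_) (ℤ.abs-* (+ k) (+ k))))))
      (ℕ.m<m*n ℤ.∣ y ∣ (k ℕ.* k) {{ℤ.≢-nonZero y≢0}} (ℕ.*-mono-< 1<k 1<k))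
  ...   | d , s , y≡ds² , sf = d , s ℤ.* + k ,
    trans z≡yk² (trans (cong (ℤ._* (+ k ℤ.* + k)) y≡ds²) (lemma d s (+ k))) , sf
  go z z≢0 (acc rec) | no noSquare = z , 1ℤ , lemma₁ z , record
    { nonZero    = ℤ.≢-nonZero z≢0
    ; squarefree = λ k k²∣z → ∣ᵤ⇒∣ (small k ℤ.∣ k ∣ refl k²∣z)
    }
    where
    small : ∀ k n → ℤ.∣ k ∣ ≡ n → k ℤ.* k ∣ z → n ℕ.∣ 1
    small k 0 ∣k∣≡0 k²∣z = contradiction
      (0∣⇒≡0 (subst (λ k → k ℤ.* k ∣ z) (ℤ.∣i∣≡0⇒i≡0 {k} ∣k∣≡0) k²∣z)) z≢0
    small k 1 _ _ = ℕ.∣-refl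
    small k n@(suc (suc _)) ∣k∣≡n k²∣z = contradiction
      (n , s≤s (ℕ.≤-trans (ℕ.m≤m*n n n) (ℕ.∣⇒≤ {{ℤ.≢-nonZero z≢0}} n²∣ᵤz)) , s≤s (s≤s z≤n) ,
        subst (_∣ z) (ℤ.pos-* n n) (∣ᵤ⇒∣ n²∣ᵤz)) noSquare
      where
      n²∣ᵤz : n ℕ.* n ℕ.∣ ℤ.∣ z ∣
      n²∣ᵤz = subst (ℕ._∣ ℤ.∣ z ∣) (trans (ℤ.abs-* k k) (cong₂ ℕ._*_ ∣k∣≡n ∣k∣≡n)) (∣⇒∣ᵤ k²∣z)

prime-∣-squarefreePart : ∀ {q} → Prime q → ∀ d s →
  + q ∣ d ℤ.* (s ℤ.* s) → ¬ + q ℤ.* + q ∣ d ℤ.* (s ℤ.* s) → + q ∣ d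
prime-∣-squarefreePart {q} pr d s q∣ q²∤ with prime∣*⇒∣⊎∣ pr d (s ℤ.* s) q∣
... | inj₁ q∣d  = q∣d
... | inj₂ q∣s² = contradiction (q²∣ ([ id , id ]′ (prime∣*⇒∣⊎∣ pr s s q∣s²))) q²∤
  where
  q²∣ : + q ∣ s → + q ℤ.* + q ∣ d ℤ.* (s ℤ.* s)
  q²∣ (divides t refl) = ∣n⇒∣m*n d (divides (t ℤ.* t) (lemma t (+ q)))
    where
    lemma : ∀ t q → t ℤ.* q ℤ.* (t ℤ.* q) ≡ t ℤ.* t ℤ.* (q ℤ.* q)
    lemma = solve-∀

squarefreePart : ∀ z d s → z ≡ d ℤ.* (s ℤ.* s) → Squarefree d → IsSquarefreePart (fromℤ z) d
squarefreePart z d s z≡ds² sf = record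
  { isSquarefree = sf
  ; isSquare     = fromℤ s , (begin
      fromℤ z ℚ.* D⁻¹                     ≡⟨ cong (λ z → fromℤ z ℚ.* D⁻¹) z≡ds² ⟩
      fromℤ (d ℤ.* (s ℤ.* s)) ℚ.* D⁻¹     ≡⟨ cong (ℚ._* D⁻¹) (fromℤ-* d (s ℤ.* s)) ⟩
      fromℤ d ℚ.* fromℤ (s ℤ.* s) ℚ.* D⁻¹ ≡⟨ cong (ℚ._* D⁻¹) (ℚ.*-comm (fromℤ d) (fromℤ (s ℤ.* s))) ⟩
      fromℤ (s ℤ.* s) ℚ.* fromℤ d ℚ.* D⁻¹ ≡⟨ ℚ.*-assoc (fromℤ (s ℤ.* s)) (fromℤ d) D⁻¹ ⟩
      fromℤ (s ℤ.* s) ℚ.* (fromℤ d ℚ.* D⁻¹) ≡⟨ cong (fromℤ (s ℤ.* s) ℚ.*_) (ℚ.*-inverseʳ (fromℤ d)) ⟩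
      fromℤ (s ℤ.* s) ℚ.* ℚ.1ℚ            ≡⟨ ℚ.*-identityʳ (fromℤ (s ℤ.* s)) ⟩
      fromℤ (s ℤ.* s)                     ≡⟨ fromℤ-* s s ⟩
      fromℤ s ℚ.* fromℤ s                 ∎)
  }
  where
  open ≡-Reasoning
  instance
    _ : ℤ.NonZero d
    _ = Squarefree.nonZero sf
  D⁻¹ = ℚ.1/ fromℤ d

∣∈∣≤sum : ∀ {x xs} → x ∈ xs → ℤ.∣ x ∣ ≤ ℕ.sum (map ℤ.∣_∣ xs)
∣∈∣≤sum {xs = x ∷ xs} (here refl) = ℕ.m≤m+n ℤ.∣ x ∣ _
∣∈∣≤sum {xs = y ∷ xs} (there x∈)  = ℕ.≤-trans (∣∈∣≤sum x∈) (ℕ.m≤n+m _ ℤ.∣ y ∣)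

proposition2p4 : (f : ℤ[x].Poly) → Nonconstant f → Separable f →
    (T : List ℕ) → All (R f) T →
    Infinite (λ d → 𝒮 f d × All (λ q → + q ∣ d) T)
proposition2p4 f nonconstant separable T T⊆R xs =
  d , ((fromℤ a , f⟨a⟩≢0 , subst (λ r → IsSquarefreePart r d) (sym f⟨a⟩≡) (squarefreePart (ev f a) d s fa≡ds² sf)) ,
       All.tail q∣d) ,
  λ d∈xs → ℕ.<⇒≱ B<p (ℕ.≤-trans (ℕ.∣⇒≤ {{Squarefree.nonZero sf}} (∣⇒∣ᵤ (All.head q∣d))) (∣∈∣≤sum d∈xs))
  where
  large = simpleRoots-large f nonconstant separable (ℕ.sum (map ℤ.∣_∣ xs))
  p = proj₁ large
  B<p = proj₁ (proj₂ large)

  simples : All (SimpleRoots f) (p ∷ T)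
  simples = proj₂ (proj₂ large) ∷ All.map (R⇒simpleRoots nonconstant) T⊆R

  open SimultaneousRoot (simultaneousRoot simples) renaming (value to a)

  fa≢0 : ev f a ≢ 0ℤ
  fa≢0 fa≡0 = proj₂ (All.head exact) (subst (+ p ℤ.* + p ∣_) (sym fa≡0) (divides 0ℤ refl))

  decomposition = squarefree-decomposition (ev f a) fa≢0
  d = proj₁ decomposition
  s = proj₁ (proj₂ decomposition)
  fa≡ds² = proj₁ (proj₂ (proj₂ decomposition))
  sf = proj₂ (proj₂ (proj₂ decomposition))

  q∣d : All (λ q → + q ∣ d) (p ∷ T)
  q∣d = All.zipWith (λ {q} (simple , q∣fa , q²∤fa) → prime-∣-squarefreePart (SimpleRoots.isPrime simple) d s
    (subst (+ q ∣_) fa≡ds² q∣fa) (λ q²∣ → q²∤fa (subst (+ q ℤ.* + q ∣_) (sym fa≡ds²) q²∣))) (simples , exact)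

  f⟨a⟩≡ : f ⟨ fromℤ a ⟩ ≡ fromℤ (ev f a)
  f⟨a⟩≡ = eval-map ℤ.+-*-commutativeRing ℚ.+-*-commutativeRing fromℤ-isHom f a

  f⟨a⟩≢0 : f ⟨ fromℤ a ⟩ ≢ 0ℚ
  f⟨a⟩≢0 eq = fa≢0 (fromℤ-injective (trans (sym f⟨a⟩≡) eq))
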